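{- Assume the Morris–Sinclair mixing bound: for every $\alpha>0$ there is a constant $C_\alpha$ such that for all $n$, $\vec a$, $b$, the chain $P_{\rm Kna}$ satisfies $\tau(1/4)\le C_\alpha n^{9/2+\alpha}$. Then for every $\alpha>0$ there is a constant $C'_\alpha$ such that, for the SRT router model and for the billiard router model corresponding to $P_{\rm Kna}$ (for any $n,\vec a,b$ and any initial configuration), $\left|\chi^{(T)}_w-\mu^{(T)}_w\right|\le C'_\alpha n^{11/2+\alpha}$ for all $w\in\Omega_{\rm Kna}$ and $T\ge0$.
   Context: Given $\vec a\in\mathbb{Z}_{>0}^n$ and $b\in\mathbb{Z}_{>0}$, $\Omega_{\rm Kna}=\{\vec x\in\{0,1\}^n:\sum_i a_ix_i\le b\}$, $\mathcal N_{\rm Kna}(\vec x)=\{\vec y\in\Omega_{\rm Kna}:\|\vec x-\vec y\|_1=1\}$, and $P_{\rm Kna}(\vec x,\vec y)=1/(2n)$ if $\vec y\in\mathcal N_{\rm Kna}(\vec x)$, $1-|\mathcal N_{\rm Kna}(\vec x)|/(2n)$ if $\vec y=\vec x$, and $0$ otherwise; it is symmetric, ergodic, with uniform stationary distribution. For a stochastic matrix $P$ on a finite set $V$ with stationary distribution $\pi$: $\mathcal N(v)=\{u:P_{v,u}>0\}$; $d_{TV}(\xi,\zeta)=\frac12\|\xi-\zeta\|_1$; $\tau(\varepsilon)=\max_v\min\{t\ge0:d_{TV}(P^t_{v,\cdot},\pi)\le\varepsilon\}$. A functional-router model consists of $\sigma_v:\mathbb{Z}_{\ge0}\to\mathcal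 N(v)$; $I_{v,u}[z,z')=|\{j\in\{z,\dots,z'-1\}:\sigma_v(j)=u\}|$; given $\chi^{(0)}\in\mathbb{Z}_{\ge0}^V$, $Z^{(t)}_{v,u}=I_{v,u}\big[\sum_{s<t}\chi^{(s)}_v,\sum_{s\le t}\chi^{(s)}_v\big)$, $\chi^{(t+1)}_u=\sum_vZ^{(t)}_{v,u}$, $\mu^{(t)}=\chi^{(0)}P^t$. SRT router: with $T_i(v)=\{u\in\mathcal N(v):I_{v,u}[0,i)-(i+1)P_{v,u}<0\}$, $\sigma_v(i)$ is some $u\in T_i(v)$ minimizing $(I_{v,u}[0,i)+1)/P_{v,u}$. Billiard router: $\sigma_v(i)$ is some $u\in\mathcal N(v)$ minimizing $(I_{v,u}[0,i)+1)/P_{v,u}$. (Known: for the SRT router $|I_{v,u}[0,z)-zP_{v,u}|<1$ for all $z>0$; for the billiard router $|I_{v,u}[z,z')-(z'-z)P_{v,u}|\le1+(|\mathcal N(v)|-2)P_{v,u}$ for $z'>z$.) -}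

module Defs where

open import Algebra.Definitions.RawSemiring using (_^_)
open import Data.Bool using (if_then_else_)
open import Data.Fin using (Fin; toℕ)
open import Data.Integer using (+_)
open import Data.List using (List; []; _∷_; length; allFin; filter; map; foldr; applyUpTo; cartesianProductWith)
open import Data.List.Membership.Propositional using (_∈_)
open import Data.List.Membership.Propositional.Properties using (∈-length; ∈-allFin; ∈-cartesianProductWith⁺)
open import Data.List.Relation.Unary.All as All using ([]; _∷_)
open import Data.List.Relation.Unary.Any using (here; there)
open import Data.List.Relation.Unary.Unique.Propositional using (Unique; []; _∷_)
import Data.List.Relation.Unary.Unique.Propositional.Properties as Unique
open import Data.Irrelevant using () renaming ([_] to [_]ⁱ)
open import Data.Nat as ℕ using (ℕ; zero; suc; NonZero)
import Data.Nat.ListAction as ℕ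
import Data.Nat.Properties as ℕ
open import Data.Product using (Σ; ∃; ∃-syntax; _×_; _,_; proj₁)
open import Data.Rational
  using (ℚ; 0ℚ; 1ℚ; ½; _/_; _+_; _-_; _*_; _÷_; -_; _<_; _≤_; ∣_∣; >-nonZero)
open import Data.Rational.Properties
  using (+-*-rawSemiring; +-assoc; +-identityʳ; +-inverseˡ; +-inverseʳ; +-monoˡ-<)
open import Data.Refinement using (Refinement; Refinement-syntax; value) renaming (_,_ to _,ᵣ_)
import Data.Refinement.Properties as Refinement
open import Data.Sum using (_⊎_)
open import Data.Vec as Vec using (Vec; []; _∷_)
open import Data.Vec.Properties using (≡-dec; ∷-injective)
import Data.Fin.Properties as Fin
open import Relation.Binary.Definitions using (DecidableEquality)
open import Relation.Binary.PropositionalEquality using (_≡_; refl; sym; trans; cong; subst)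
open import Relation.Nullary using (¬_; Dec; yes; no; ⌊_⌋)
open import Relation.Nullary.Negation using (contradiction-irr)

fromℕ : ℕ → ℚ
fromℕ m = + m / 1

-- Located Dedekind cuts

record ℝ : Set₁ where
  field
    L U         : ℚ → Set
    L-inhabited : ∃ L
    U-inhabited : ∃ U
    L-lower     : ∀ {q r} → q < r → L r → L q
    L-open      : ∀ {q} → L q → ∃[ r ] (q < r × L r)
    U-upper     : ∀ {q r} → q < r → U q → U r
    U-open      : ∀ {r} → U r → ∃[ q ] (q < r × U q)
    disjoint    : ∀ {q} → ¬ (L q × U q)
    located     : ∀ {q r} → q < r → L q ⊎ U r

Positiveʳ : ℝ → Set
Positiveʳ α = ℝ.L α 0ℚ

infixr 6 _+ʳ_

_+ʳ_ : ℚ → ℝ → ℝ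
e +ʳ α = record
  { L           = λ q → L (q - e)
  ; U           = λ q → U (q - e)
  ; L-inhabited = let q , l = L-inhabited in q + e , subst L (sym (+-- q)) l
  ; U-inhabited = let q , u = U-inhabited in q + e , subst U (sym (+-- q)) u
  ; L-lower     = λ q<r → L-lower (+-monoˡ-< (- e) q<r)
  ; L-open      = λ {q} l → let r , q<r , l′ = L-open l in
                    r + e , subst (_< r + e) (-+ q) (+-monoˡ-< e q<r) , subst L (sym (+-- r)) l′
  ; U-upper     = λ q<r → U-upper (+-monoˡ-< (- e) q<r)
  ; U-open      = λ {r} u → let q , q<r , u′ = U-open u in
                    q + e , subst (q + e <_) (-+ r) (+-monoˡ-< e q<r) , subst U (sym (+-- q)) u′
  ; disjoint    = disjoint
  ; located     = λ q<r → located (+-monoˡ-< (- e) q<r)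
  }
  where
  open ℝ α

  +-- : ∀ q → (q + e) - e ≡ q
  +-- q = trans (+-assoc q e (- e)) (trans (cong (_+_ q) (+-inverseʳ e)) (+-identityʳ q))

  -+ : ∀ q → (q - e) + e ≡ q
  -+ q = trans (+-assoc q (- e) e) (trans (cong (_+_ q) (+-inverseˡ e)) (+-identityʳ q))

infixr 8 _^ℚ_

_^ℚ_ : ℚ → ℕ → ℚ
_^ℚ_ = _^_ +-*-rawSemiring

-- The inequality x ≤ C · n^r, for x ≥ 0, C > 0, n ≥ 1 and r ≥ 0.  Since
-- (c , s) ↦ c · n^s is continuous and nondecreasing there, C · n^r is the
-- infimum of c · n^(p/q) over the rationals c > C and p/q > r, and
-- x ≤ c · n^(p/q) means x^q ≤ c^q · n^p.
infix 4 _≤_·_^_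

_≤_·_^_ : ℚ → ℝ → ℕ → ℝ → Set
x ≤ C · n ^ r = ∀ (c : ℚ) (p q : ℕ) .{{_ : NonZero q}} →
  ℝ.U C c → ℝ.U r (+ p / q) → x ^ℚ q ≤ c ^ℚ q * fromℕ n ^ℚ p

record FiniteSet : Set₁ where
  infix 4 _≟_
  field
    Carrier  : Set
    _≟_      : DecidableEquality Carrier
    elements : List Carrier
    complete : ∀ x → x ∈ elements
    unique   : Unique elements

open FiniteSet using (Carrier)

-- The argument v only witnesses that V is nonempty, so that 1/|V| exists.
uniform : (V : FiniteSet) → Carrier V → ℚ
uniform V v = (+ 1 / length elements) {{ℕ.>-nonZero (∈-length (complete v))}}
  where open FiniteSet V hiding (Carrier)

IsMinimum : (ℕ → Set) → ℕ → Set
IsMinimum Q t = Q t × (∀ s → Q s → t ℕ.≤ s)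

module Chain (V : FiniteSet) (P : Carrier V → Carrier V → ℚ) where

  open FiniteSet V hiding (Carrier)

  ∑ : (Carrier V → ℚ) → ℚ
  ∑ f = foldr _+_ 0ℚ (map f elements)

  ∑ℕ : (Carrier V → ℕ) → ℕ
  ∑ℕ f = ℕ.sum (map f elements)

  _∈𝒩_ : Carrier V → Carrier V → Set
  u ∈𝒩 v = 0ℚ < P v u

  P^ : ℕ → Carrier V → Carrier V → ℚ
  P^ zero    v w = if ⌊ v ≟ w ⌋ then 1ℚ else 0ℚ
  P^ (suc t) v w = ∑ λ u → P^ t v u * P u w

  dTV : (ξ ζ : Carrier V → ℚ) → ℚ
  dTV ξ ζ = ½ * ∑ λ v → ∣ ξ v - ζ v ∣

  IsMixingTimeFrom : (π : Carrier V → ℚ) → ℚ → Carrier V → ℕ → Set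
  IsMixingTimeFrom π ε v = IsMinimum λ t → dTV (P^ t v) π ≤ ε

  -- t = max_v min { s | dTV (P^ s v) π ≤ ε }, a relation because the minima
  -- exist only when the chain mixes.
  IsMixingTime : (π : Carrier V → ℚ) → ℚ → ℕ → Set
  IsMixingTime π ε t =
    (∀ v → ∃[ s ] (IsMixingTimeFrom π ε v s × s ℕ.≤ t)) ×
    (∃[ v ] IsMixingTimeFrom π ε v t)

  Router : Set
  Router = Carrier V → ℕ → Carrier V

  module _ (σ : Router) where

    I[_,_] : (v u : Carrier V) (z z′ : ℕ) → ℕ
    I[ v , u ] z z′ = length (filter (λ j → σ v j ≟ u) (applyUpTo (ℕ._+_ z) (z′ ℕ.∸ z)))

    -- (I_{v,u}[0,i) + 1) / P_{v,u}
    priority : ∀ v u → u ∈𝒩 v → ℕ → ℚ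
    priority v u 0<P i =
      (fromℕ (I[ v , u ] 0 i) + 1ℚ) ÷ P v u
      where instance _ = >-nonZero 0<P

    IsFunctionalRouter : Set
    IsFunctionalRouter = ∀ v j → σ v j ∈𝒩 v

    _∈T⟨_,_⟩ : Carrier V → ℕ → Carrier V → Set
    u ∈T⟨ i , v ⟩ = u ∈𝒩 v × fromℕ (I[ v , u ] 0 i) - fromℕ (suc i) * P v u < 0ℚ

    IsSRT : Set
    IsSRT = ∀ v i → Σ (σ v i ∈T⟨ i , v ⟩) λ σ∈T →
      ∀ u (u∈T : u ∈T⟨ i , v ⟩) → priority v (σ v i) (proj₁ σ∈T) i ≤ priority v u (proj₁ u∈T) i

    IsBilliard : Set
    IsBilliard = ∀ v i → Σ (σ v i ∈𝒩 v) λ σ∈𝒩 →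
      ∀ u (u∈𝒩 : u ∈𝒩 v) → priority v (σ v i) σ∈𝒩 i ≤ priority v u u∈𝒩 i

    module _ (χ₀ : Carrier V → ℕ) where

      -- before t v = ∑_{s<t} χ s v
      χ before : ℕ → Carrier V → ℕ
      Z : ℕ → (v u : Carrier V) → ℕ

      χ zero    u = χ₀ u
      χ (suc t) u = ∑ℕ λ v → Z t v u

      before zero    v = 0
      before (suc t) v = before t v ℕ.+ χ t v

      Z t v u = I[ v , u ] (before t v) (before t v ℕ.+ χ t v)

  μ : (χ₀ : Carrier V → ℕ) → ℕ → Carrier V → ℚ
  μ χ₀ t w = ∑ λ v → fromℕ (χ₀ v) * P^ t v w

𝔹 : ℕ → Set
𝔹 n = Vec (Fin 2) n

weight : ∀ {n} → Vec ℕ n → 𝔹 n → ℕ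
weight a x = Vec.sum (Vec.zipWith (λ aᵢ xᵢ → aᵢ ℕ.* toℕ xᵢ) a x)

‖_-_‖₁ : ∀ {n} → 𝔹 n → 𝔹 n → ℕ
‖ x - y ‖₁ = Vec.sum (Vec.zipWith (λ xᵢ yᵢ → ℕ.∣ toℕ xᵢ - toℕ yᵢ ∣) x y)

allVectors : ∀ n → List (𝔹 n)
allVectors zero    = [] ∷ []
allVectors (suc n) = cartesianProductWith _∷_ (allFin 2) (allVectors n)

allVectors-complete : ∀ {n} (x : 𝔹 n) → x ∈ allVectors n
allVectors-complete []      = here refl
allVectors-complete (i ∷ x) =
  ∈-cartesianProductWith⁺ _∷_ (∈-allFin i) (allVectors-complete x)

allVectors-unique : ∀ n → Unique (allVectors n)
allVectors-unique zero    = [] ∷ []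
allVectors-unique (suc n) =
  Unique.cartesianProductWith⁺ _∷_ ∷-injective
    (Unique.allFin⁺ 2) (allVectors-unique n)

module Knapsack {n : ℕ} (a : Vec ℕ n) (b : ℕ) where

  Solution : Set
  Solution = [ x ∈ 𝔹 n ∣ weight a x ℕ.≤ b ]

  solutions : List (𝔹 n) → List Solution
  solutions []       = []
  solutions (x ∷ xs) with weight a x ℕ.≤? b
  ... | yes x≤b = (x ,ᵣ [ x≤b ]ⁱ) ∷ solutions xs
  ... | no  _   = solutions xs

  ∈-solutions⁺ : ∀ {xs} (x : Solution) → value x ∈ xs → x ∈ solutions xs
  ∈-solutions⁺ {y ∷ _} x x∈xs with weight a y ℕ.≤? b
  ∈-solutions⁺ x (here refl) | yes _ = here refl
  ∈-solutions⁺ x (there x∈)  | yes _ = there (∈-solutions⁺ x x∈)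
  ∈-solutions⁺ (x ,ᵣ [ x≤b ]ⁱ) (here refl) | no x≰b = contradiction-irr x≤b x≰b
  ∈-solutions⁺ x (there x∈)  | no _ = ∈-solutions⁺ x x∈

  ∈-solutions⁻ : ∀ {xs} {x : Solution} → x ∈ solutions xs → value x ∈ xs
  ∈-solutions⁻ {y ∷ _} x∈ with weight a y ℕ.≤? b
  ∈-solutions⁻ (here refl) | yes _ = here refl
  ∈-solutions⁻ (there x∈)  | yes _ = there (∈-solutions⁻ x∈)
  ∈-solutions⁻ x∈          | no _  = there (∈-solutions⁻ x∈)

  solutions-unique : ∀ {xs} → Unique xs → Unique (solutions xs)
  solutions-unique {[]}     []         = []
  solutions-unique {x ∷ xs} (x∉ ∷ xs!) with weight a x ℕ.≤? b
  ... | yes _ = All.tabulate (λ y∈ x≡y → All.lookup x∉ (∈-solutions⁻ y∈) (cong value x≡y))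
                ∷ solutions-unique xs!
  ... | no _  = solutions-unique xs!

  Ω : FiniteSet
  Ω = record
    { Carrier  = Solution
    ; _≟_      = Refinement._≟_ (≡-dec Fin._≟_)
    ; elements = solutions (allVectors n)
    ; complete = λ x → ∈-solutions⁺ x (allVectors-complete (value x))
    ; unique   = solutions-unique (allVectors-unique n)
    }

  open FiniteSet Ω using (_≟_; elements)

  adjacent? : (x y : Solution) → Dec (‖ value x - value y ‖₁ ≡ 1)
  adjacent? x y = ‖ value x - value y ‖₁ ℕ.≟ 1

  𝒩-Kna : Solution → List Solution
  𝒩-Kna x = filter (adjacent? x) elements

  P-Kna : .{{_ : NonZero n}} → Solution → Solution → ℚ
  P-Kna x y =
    if ⌊ adjacent? x y ⌋ then + 1 / (2 ℕ.* n)
    else if ⌊ x ≟ y ⌋ then 1ℚ - + length (𝒩-Kna x) / (2 ℕ.* n)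
    else 0ℚ
    where instance _ = ℕ.m*n≢0 2 n

{-# OPTIONS --safe #-}

-- Write f P^ s for the configuration f pushed s steps by the chain.  Telescoping
-- gives χ⁽ᵀ⁾ − μ⁽ᵀ⁾ = ∑_{t<T} E⁽ᵗ⁾ P^(T−1−t), where E⁽ᵗ⁾ = χ⁽ᵗ⁺¹⁾ − χ⁽ᵗ⁾P sums to
-- zero, so that P^ s may be replaced by P^ s − π.  With D = 2n, every positive
-- entry of P is at least 1/D, and both routers satisfy |I[0,z) − zP| ≤ D P; hence
-- |E⁽ᵗ⁾| ≤ 2D.  As d_TV(P^τ, π) ≤ 1/4 halves the ℓ¹-norm of every function of sum
-- zero, ∑_s ‖P^ s(w,·) − π‖₁ ≤ 2 · τ · 2, and altogether |χ⁽ᵀ⁾ − μ⁽ᵀ⁾| ≤ 8Dτ = 16nτ.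

module Submission where

open import Defs
open import Algebra.Bundles using (CommutativeRing)
import Algebra.Properties.CommutativeSemiring.Exp as CommutativeSemiringExp
open import Data.Bool using (if_then_else_)
open import Data.Empty using (⊥; ⊥-elim)
open import Data.Fin using (Fin; toℕ; zero; suc; opposite)
import Data.Fin.Properties as Fin
open import Data.Integer as ℤ using (+_)
import Data.Integer.Properties as ℤ
open import Data.List as List using (List; []; _∷_; _++_; length; filter; map; foldr; allFin; applyUpTo)
open import Data.List.Membership.Propositional using (_∈_)
open import Data.List.Membership.Propositional.Properties using (∈-length; ∈-lookup; ∈-filter⁻; ∈-map⁺; ∈-allFin)
import Data.List.Membership.Setoid.Properties as Membership
open import Data.List.Properties using (applyUpTo-∷ʳ; filter-++; length-++; length-map; length-tabulate)
open import Data.List.Relation.Unary.All as All using ([]; _∷_)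
open import Data.List.Relation.Unary.Any using (here; there; index)
open import Data.List.Relation.Unary.Unique.Propositional using (Unique; []; _∷_)
import Data.List.Relation.Unary.Unique.Propositional.Properties as Unique
open import Data.Nat as ℕ using (ℕ; zero; suc; NonZero; _>_)
import Data.Nat.Coprimality as Coprimality
import Data.Nat.ListAction as ℕ
import Data.Nat.Properties as ℕ
open import Data.Product using (Σ; ∃; ∃-syntax; _×_; _,_; proj₁; proj₂)
open import Data.Rational
  using ( ℚ; 0ℚ; 1ℚ; ½; _/_; _+_; _-_; _*_; _÷_; -_; 1/_; _<_; _≤_; ∣_∣; toℚᵘ; mkℚ
        ; Positive; nonNegative; positive; >-nonZero )
open import Data.Rational.Properties
  using ( _≤?_; _<?_; ≤-refl; ≤-reflexive; ≤-trans; ≤-antisym; <⇒≤; <-irrefl; ≰⇒>; ≮⇒≥; <-≤-trans; ≤-<-trans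
        ; +-*-commutativeRing; +-assoc; +-identityˡ; +-identityʳ; +-inverseʳ
        ; +-mono-≤; +-monoˡ-≤; +-monoʳ-≤; +-monoˡ-<; +-monoʳ-<; neg-antimono-≤
        ; *-assoc; *-comm; *-identityˡ; *-identityʳ; *-zeroˡ; *-zeroʳ; *-distribˡ-+; *-distribʳ-+; *-inverseˡ
        ; *-monoʳ-≤-nonNeg; *-monoˡ-≤-nonNeg; *-monoˡ-<-pos; *-monoʳ-<-pos; *-cancelˡ-≤-pos; *-cancelʳ-<-nonNeg
        ; ∣p+q∣≤∣p∣+∣q∣; ∣p-q∣≤∣p∣+∣q∣; ∣p*q∣≡∣p∣*∣q∣; ∣p∣≡p∨∣p∣≡-p; 0≤∣p∣; 0≤p⇒∣p∣≡p
        ; nonNegative⁻¹; positive⁻¹; normalize-nonNeg; normalize-pos; normalize-coprime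
        ; toℚᵘ-injective; toℚᵘ-fromℚᵘ; toℚᵘ-homo-*; module ≤-Reasoning )
import Data.Rational.Properties as ℚ
import Data.Rational.Unnormalised as ℚᵘ
import Data.Rational.Unnormalised.Properties as ℚᵘ
open import Data.Refinement using (value)
import Data.Refinement.Properties as Refinement
open import Data.Sum as Sum using (_⊎_; inj₁; inj₂; [_,_]′)
open import Data.Vec using (Vec; []; _∷_; updateAt)
open import Data.Vec.Relation.Unary.All using (All)
open import Function using (id)
open import Level using (0ℓ)
open import Relation.Binary.Definitions using (DecidableEquality)
open import Relation.Binary.PropositionalEquality
open import Relation.Nullary using (¬_; Dec; yes; no; ⌊_⌋; contradiction)
open import Relation.Nullary.Decidable using (dec⇒maybe; toWitness)
open import Relation.Unary using (Pred; Decidable)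
open import Tactic.RingSolver using (solve-∀)
open import Tactic.RingSolver.Core.AlmostCommutativeRing using (AlmostCommutativeRing; fromCommutativeRing)

-- The discrepancy of a router is bounded by a multiple of `P v u` rather than by a constant. The
-- error at u collects a contribution from every v, and bounds proportional to `P v u` add up to a
-- column sum, which is 1 by symmetry. A loss of one unit fits this form because it is at most
-- `D * P v u` wherever `P v u` is positive. Both routers obey one scheduling rule. Let u demand its
-- j-th visit by time j / P. Each router picks the earliest deadline among candidates that include
-- every u whose next visit is already released, and optimality of this rule yields the lower bound
-- on visits. The upper bound is where the routers differ: the SRT router only chooses released
-- vertices, whereas the billiard router may run ahead and is controlled by averaging its priorities
-- over all u with weights P. The only power of n gained over the mixing time is the factor D, which
-- raises the exponent by exactly one and leaves α as it is.

ℚ-ring : AlmostCommutativeRing _ _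
ℚ-ring = fromCommutativeRing +-*-commutativeRing (λ p → dec⇒maybe (0ℚ ℚ.≟ p))

-- Natural numbers inside the rationals, and order.

fromℕ-+ : ∀ m n → fromℕ (m ℕ.+ n) ≡ fromℕ m + fromℕ n
fromℕ-+ m n = sym (begin
  fromℕ m + fromℕ n                            ≡⟨ cong₂ _+_ (normal m) (normal n) ⟩
  (+ m ℤ.* + 1 ℤ.+ + n ℤ.* + 1) / 1            ≡⟨ cong (_/ 1) (cong₂ ℤ._+_ (ℤ.*-identityʳ (+ m)) (ℤ.*-identityʳ (+ n))) ⟩
  fromℕ (m ℕ.+ n)                              ∎)
  where
  open ≡-Reasoning
  -- `+ k / 1` is normalised through a gcd and does not reduce for a variable k. In constructor form
  -- the sum unfolds.
  normal : ∀ k → fromℕ k ≡ mkℚ (+ k) 0 (Coprimality.sym (Coprimality.1-coprimeTo k))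
  normal k = normalize-coprime (Coprimality.sym (Coprimality.1-coprimeTo k))

fromℕ-suc : ∀ n → fromℕ (suc n) ≡ fromℕ n + 1ℚ
fromℕ-suc n = trans (cong fromℕ (ℕ.+-comm 1 n)) (fromℕ-+ n 1)

c+m*c : ∀ m c → c + fromℕ m * c ≡ fromℕ (suc m) * c
c+m*c m c = trans (distrib c (fromℕ m)) (cong (_* c) (sym (fromℕ-suc m)))
  where
  distrib : ∀ c m → c + m * c ≡ (m + 1ℚ) * c
  distrib = solve-∀ ℚ-ring

/-*-cancel : ∀ m n .{{_ : NonZero n}} → (+ m / n) * fromℕ n ≡ fromℕ m
/-*-cancel m (suc d) = toℚᵘ-injective (begin
  toℚᵘ ((+ m / suc d) * fromℕ (suc d))                     ≈⟨ toℚᵘ-homo-* (+ m / suc d) (fromℕ (suc d)) ⟩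
  toℚᵘ (+ m / suc d) ℚᵘ.* toℚᵘ (fromℕ (suc d))             ≈⟨ ℚᵘ.*-cong (toℚᵘ-fromℚᵘ (ℚᵘ.mkℚᵘ (+ m) d)) (toℚᵘ-fromℚᵘ (ℚᵘ.mkℚᵘ (+ suc d) 0)) ⟩
  ℚᵘ.mkℚᵘ (+ m) d ℚᵘ.* ℚᵘ.mkℚᵘ (+ suc d) 0                 ≈⟨ ℚᵘ.*≡* (trans (ℤ.*-identityʳ _) (cong (λ k → + m ℤ.* + suc k) (sym (ℕ.*-identityʳ d)))) ⟩
  ℚᵘ.mkℚᵘ (+ m) 0                                          ≈⟨ toℚᵘ-fromℚᵘ (ℚᵘ.mkℚᵘ (+ m) 0) ⟨
  toℚᵘ (fromℕ m)                                           ∎)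
  where open ℚᵘ.≃-Reasoning

m/n≡m*1/n : ∀ m n .{{_ : NonZero n}} → + m / n ≡ fromℕ m * (+ 1 / n)
m/n≡m*1/n m n = begin
  + m / n                              ≡⟨ *-identityʳ (+ m / n) ⟨
  (+ m / n) * 1ℚ                       ≡⟨ cong (_*_ (+ m / n)) (/-*-cancel 1 n) ⟨
  (+ m / n) * ((+ 1 / n) * fromℕ n)    ≡⟨ swap (+ m / n) (+ 1 / n) (fromℕ n) ⟩
  (+ m / n) * fromℕ n * (+ 1 / n)      ≡⟨ cong (_* (+ 1 / n)) (/-*-cancel m n) ⟩
  fromℕ m * (+ 1 / n)                  ∎
  where
  open ≡-Reasoning
  swap : ∀ a b c → a * (b * c) ≡ a * c * b
  swap = solve-∀ ℚ-ring

0≤/ : ∀ m n .{{_ : NonZero n}} → 0ℚ ≤ + m / n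
0≤/ m n = nonNegative⁻¹ (+ m / n) {{normalize-nonNeg m n}}

0≤fromℕ : ∀ n → 0ℚ ≤ fromℕ n
0≤fromℕ n = 0≤/ n 1

<⇒≱ : ∀ {p q} → p < q → ¬ (q ≤ p)
<⇒≱ p<q q≤p = <-irrefl refl (<-≤-trans p<q q≤p)

≤-+ʳ : ∀ {p q} → 0ℚ ≤ q → p ≤ p + q
≤-+ʳ {p} 0≤q = ≤-trans (≤-reflexive (sym (+-identityʳ p))) (+-monoʳ-≤ p 0≤q)

p<p+1 : ∀ p → p < p + 1ℚ
p<p+1 p = subst (_< p + 1ℚ) (+-identityʳ p) (+-monoʳ-< p (positive⁻¹ 1ℚ))

fromℕ-mono : ∀ {m n} → m ℕ.≤ n → fromℕ m ≤ fromℕ n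
fromℕ-mono {m} {n} m≤n = subst (λ k → fromℕ m ≤ fromℕ k) (ℕ.m+[n∸m]≡n m≤n)
  (subst (fromℕ m ≤_) (sym (fromℕ-+ m (n ℕ.∸ m))) (≤-+ʳ (0≤fromℕ (n ℕ.∸ m))))

-- Integrality of counts: a strict bound with one unit of slack already compares the counts. In
-- `fits` it shows that x was not chosen from slot k on.
fromℕ<1+fromℕ⇒≤ : ∀ m n → fromℕ m < fromℕ n + 1ℚ → m ℕ.≤ n
fromℕ<1+fromℕ⇒≤ m n m<n+1 with m ℕ.≤? n
... | yes m≤n = m≤n
... | no m≰n = contradiction
  (subst (_≤ fromℕ m) (fromℕ-suc n) (fromℕ-mono (ℕ.≰⇒> m≰n))) (<⇒≱ m<n+1)

*-monoˡ : ∀ {p q r} → 0ℚ ≤ r → p ≤ q → r * p ≤ r * q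
*-monoˡ {r = r} 0≤r = *-monoˡ-≤-nonNeg r {{nonNegative 0≤r}}

*-monoʳ : ∀ {p q r} → 0ℚ ≤ r → p ≤ q → p * r ≤ q * r
*-monoʳ {r = r} 0≤r = *-monoʳ-≤-nonNeg r {{nonNegative 0≤r}}

0≤* : ∀ {p q} → 0ℚ ≤ p → 0ℚ ≤ q → 0ℚ ≤ p * q
0≤* {p} 0≤p 0≤q = ≤-trans (≤-reflexive (sym (*-zeroʳ p))) (*-monoˡ 0≤p 0≤q)

-- Serves to see that a released vertex has positive probability, hence is a neighbour with a
-- well-defined priority.
0≤<*⇒0< : ∀ {a c p} → 0ℚ ≤ c → 0ℚ ≤ a → a < c * p → 0ℚ < p
0≤<*⇒0< {c = c} 0≤c 0≤a a<cp = ≰⇒> λ p≤0 → <⇒≱ a<cp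
  (≤-trans (≤-trans (*-monoˡ 0≤c p≤0) (≤-reflexive (*-zeroʳ c))) 0≤a)

0≤-⇒≤ : ∀ {p q} → 0ℚ ≤ q - p → p ≤ q
0≤-⇒≤ {p} {q} 0≤q-p = subst (p ≤_) (cancel p q) (≤-+ʳ 0≤q-p)
  where
  cancel : ∀ p q → p + (q - p) ≡ q
  cancel = solve-∀ ℚ-ring

≤⇒0≤- : ∀ {p q} → p ≤ q → 0ℚ ≤ q - p
≤⇒0≤- {p} p≤q = ≤-trans (≤-reflexive (sym (+-inverseʳ p))) (+-monoˡ-≤ (- p) p≤q)

-- Finite sums.

module _ {A : Set} where

  sum : List A → (A → ℚ) → ℚ
  sum xs f = foldr _+_ 0ℚ (map f xs)

  sum-cong : ∀ xs {f g : A → ℚ} → (∀ x → f x ≡ g x) → sum xs f ≡ sum xs g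
  sum-cong []       f≡g = refl
  sum-cong (x ∷ xs) f≡g = cong₂ _+_ (f≡g x) (sum-cong xs f≡g)

  sum-mono : ∀ xs {f g : A → ℚ} → (∀ x → f x ≤ g x) → sum xs f ≤ sum xs g
  sum-mono []       f≤g = ≤-refl
  sum-mono (x ∷ xs) f≤g = +-mono-≤ (f≤g x) (sum-mono xs f≤g)

  sum-+ : ∀ xs (f g : A → ℚ) → sum xs (λ x → f x + g x) ≡ sum xs f + sum xs g
  sum-+ []       f g = refl
  sum-+ (x ∷ xs) f g = trans (cong (_+_ (f x + g x)) (sum-+ xs f g))
    (interchange (f x) (g x) (sum xs f) (sum xs g))
    where
    interchange : ∀ a b c d → (a + b) + (c + d) ≡ (a + c) + (b + d)
    interchange = solve-∀ ℚ-ring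

  sum-*ˡ : ∀ xs c (f : A → ℚ) → sum xs (λ x → c * f x) ≡ c * sum xs f
  sum-*ˡ []       c f = sym (*-zeroʳ c)
  sum-*ˡ (x ∷ xs) c f = trans (cong (_+_ (c * f x)) (sum-*ˡ xs c f))
    (sym (*-distribˡ-+ c (f x) (sum xs f)))

  sum-*ʳ : ∀ xs (f : A → ℚ) c → sum xs (λ x → f x * c) ≡ sum xs f * c
  sum-*ʳ xs f c = trans (sum-cong xs (λ x → *-comm (f x) c))
    (trans (sum-*ˡ xs c f) (*-comm c (sum xs f)))

  sum-- : ∀ xs (f g : A → ℚ) → sum xs (λ x → f x - g x) ≡ sum xs f - sum xs g
  sum-- []       f g = refl
  sum-- (x ∷ xs) f g = trans (cong (_+_ (f x - g x)) (sum-- xs f g))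
    (interchange (f x) (g x) (sum xs f) (sum xs g))
    where
    interchange : ∀ a b c d → (a - b) + (c - d) ≡ (a + c) - (b + d)
    interchange = solve-∀ ℚ-ring

  sum-zero : ∀ xs → sum xs (λ _ → 0ℚ) ≡ 0ℚ
  sum-zero []       = refl
  sum-zero (x ∷ xs) = trans (+-identityˡ (sum xs (λ _ → 0ℚ))) (sum-zero xs)

  sum-nonneg : ∀ xs {f : A → ℚ} → (∀ x → 0ℚ ≤ f x) → 0ℚ ≤ sum xs f
  sum-nonneg xs 0≤f = ≤-trans (≤-reflexive (sym (sum-zero xs))) (sum-mono xs 0≤f)

  ∣sum∣≤ : ∀ xs (f : A → ℚ) → ∣ sum xs f ∣ ≤ sum xs (λ x → ∣ f x ∣)
  ∣sum∣≤ []       f = ≤-refl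
  ∣sum∣≤ (x ∷ xs) f = ≤-trans (∣p+q∣≤∣p∣+∣q∣ (f x) (sum xs f)) (+-monoʳ-≤ ∣ f x ∣ (∣sum∣≤ xs f))

  fromℕ-sum : ∀ xs (f : A → ℕ) → fromℕ (ℕ.sum (map f xs)) ≡ sum xs (λ x → fromℕ (f x))
  fromℕ-sum []       f = refl
  fromℕ-sum (x ∷ xs) f = trans (fromℕ-+ (f x) _) (cong (_+_ (fromℕ (f x))) (fromℕ-sum xs f))

  sum-indicator : ∀ xs {P : Pred A 0ℓ} (P? : Decidable P) c →
    sum xs (λ x → if ⌊ P? x ⌋ then c else 0ℚ) ≡ fromℕ (length (filter P? xs)) * c
  sum-indicator []       P? c = sym (*-zeroˡ c)
  sum-indicator (x ∷ xs) P? c with P? x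
  ... | yes _ = trans (cong (_+_ c) (sum-indicator xs P? c)) (c+m*c (length (filter P? xs)) c)
  ... | no _  = trans (+-identityˡ _) (sum-indicator xs P? c)

  sum-const : ∀ xs c → sum xs (λ _ → c) ≡ fromℕ (length xs) * c
  sum-const []       c = sym (*-zeroˡ c)
  sum-const (x ∷ xs) c = trans (cong (_+_ c) (sum-const xs c)) (c+m*c (length xs) c)

  sum-*-weights : ∀ xs {p : A → ℚ} → sum xs p ≡ 1ℚ → ∀ c → sum xs (λ x → c * p x) ≡ c
  sum-*-weights xs {p} ∑p≡1 c = trans (sum-*ˡ xs c p) (trans (cong (_*_ c) ∑p≡1) (*-identityʳ c))

  module _ (_≟_ : DecidableEquality A) where

    sum-point : ∀ {xs} → Unique xs → ∀ {x} → x ∈ xs → ∀ (f : A → ℚ) →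
      sum xs (λ y → if ⌊ x ≟ y ⌋ then f y else 0ℚ) ≡ f x
    sum-point {xs = _ ∷ xs} (x∉xs ∷ _) {x} (here refl) f with x ≟ x
    ... | no x≢x = contradiction refl x≢x
    ... | yes _  = trans (cong (_+_ (f x)) (trans (rest xs x∉xs) (sum-zero xs))) (+-identityʳ (f x))
      where
      rest : ∀ ys → All.All (x ≢_) ys → sum ys (λ y → if ⌊ x ≟ y ⌋ then f y else 0ℚ) ≡ sum ys (λ _ → 0ℚ)
      rest []       []         = refl
      rest (y ∷ ys) (x≢y ∷ x∉) with x ≟ y
      ... | yes x≡y = contradiction x≡y x≢y
      ... | no _    = cong (_+_ 0ℚ) (rest ys x∉)
    sum-point {xs = y ∷ xs} (y∉xs ∷ xs!) {x} (there x∈xs) f with x ≟ y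
    ... | yes refl = contradiction refl (All.lookup y∉xs x∈xs)
    ... | no _     = trans (+-identityˡ _) (sum-point xs! x∈xs f)

sum-swap : ∀ {A B : Set} xs ys (f : A → B → ℚ) →
  sum xs (λ x → sum ys (f x)) ≡ sum ys (λ y → sum xs (λ x → f x y))
sum-swap []       ys f = sym (sum-zero ys)
sum-swap (x ∷ xs) ys f = trans (cong (_+_ (sum ys (f x))) (sum-swap xs ys f))
  (sym (sum-+ ys (f x) (λ y → sum xs (λ x → f x y))))

∣p∣≤ : ∀ {p r} → p ≤ r → - p ≤ r → ∣ p ∣ ≤ r
∣p∣≤ {p} p≤r -p≤r with ∣p∣≡p∨∣p∣≡-p p
... | inj₁ eq = ≤-trans (≤-reflexive eq) p≤r
... | inj₂ eq = ≤-trans (≤-reflexive eq) -p≤r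

<⊎≥ : ∀ p q → p < q ⊎ q ≤ p
<⊎≥ p q with p <? q
... | yes p<q = inj₁ p<q
... | no p≮q  = inj₂ (≮⇒≥ p≮q)

-- The routing sequence of one vertex as a deadline schedule.

module Schedule (V : FiniteSet) (s : ℕ → FiniteSet.Carrier V) where

  open FiniteSet V

  -- The prefix counts I[0,z) of the router, by recursion on the right end so that induction on time
  -- computes. `I-count` makes the connection.
  count : Carrier → ℕ → ℕ
  count u zero    = 0
  count u (suc z) = count u z ℕ.+ (if ⌊ s z ≟ u ⌋ then 1 else 0)

  countℚ : Carrier → ℕ → ℚ
  countℚ u z = fromℕ (count u z)

  count-mono-suc : ∀ u z → count u z ℕ.≤ count u (suc z)
  count-mono-suc u z = ℕ.m≤m+n (count u z) _

  count-step : ∀ u z → count u (suc z) ≡ count u z ⊎ s z ≡ u × countℚ u (suc z) ≡ countℚ (s z) z + 1ℚ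
  count-step u z with s z ≟ u
  ... | yes refl = inj₂ (refl , fromℕ-+ (count u z) 1)
  ... | no _     = inj₁ (ℕ.+-identityʳ (count u z))

  count-mono : ∀ u d k → count u k ℕ.≤ count u (d ℕ.+ k)
  count-mono u zero    k = ℕ.≤-refl
  count-mono u (suc d) k = ℕ.≤-trans (count-mono u d k) (count-mono-suc u (d ℕ.+ k))

  countℚ-suc : ∀ u z → countℚ u (suc z) ≡ countℚ u z + (if ⌊ s z ≟ u ⌋ then 1ℚ else 0ℚ)
  countℚ-suc u z = trans (fromℕ-+ (count u z) _) (cong (_+_ (countℚ u z)) lemma)
    where
    lemma : fromℕ (if ⌊ s z ≟ u ⌋ then 1 else 0) ≡ (if ⌊ s z ≟ u ⌋ then 1ℚ else 0ℚ)
    lemma with s z ≟ u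
    ... | yes _ = refl
    ... | no _  = refl

  sum-countℚ : ∀ z → sum elements (λ u → countℚ u z) ≡ fromℕ z
  sum-countℚ zero    = sum-zero elements
  sum-countℚ (suc z) = begin
    sum elements (λ u → countℚ u (suc z))                ≡⟨ sum-cong elements (λ u → countℚ-suc u z) ⟩
    sum elements (λ u → countℚ u z + _)                  ≡⟨ sum-+ elements (λ u → countℚ u z) _ ⟩
    sum elements (λ u → countℚ u z) + sum elements _     ≡⟨ cong₂ _+_ (sum-countℚ z) (sum-point _≟_ unique (complete (s z)) (λ _ → 1ℚ)) ⟩
    fromℕ z + 1ℚ                                         ≡⟨ fromℕ-suc z ⟨
    fromℕ (suc z)                                        ∎
    where open ≡-Reasoning

  -- Pigeonhole: exactly z choices are made before time z, so capacities that cover every count and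
  -- leave a whole free unit at u sum to at least z + 1.
  not-overfull : ∀ z (c : Carrier → ℚ) u → (∀ x → countℚ x z ≤ c x) → countℚ u z + 1ℚ ≤ c u →
    ¬ (sum elements c ≤ fromℕ z)
  not-overfull z c u count≤c count+1≤c = <⇒≱ (<-≤-trans (p<p+1 (fromℕ z)) (≤-trans (≤-reflexive (sym total))
    (sum-mono elements bound)))
    where
    extra : Carrier → ℚ
    extra x = if ⌊ u ≟ x ⌋ then 1ℚ else 0ℚ
    total : sum elements (λ x → countℚ x z + extra x) ≡ fromℕ z + 1ℚ
    total = trans (sum-+ elements (λ x → countℚ x z) extra)
      (cong₂ _+_ (sum-countℚ z) (sum-point _≟_ unique (complete u) (λ _ → 1ℚ)))
    bound : ∀ x → countℚ x z + extra x ≤ c x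
    bound x with u ≟ x
    ... | yes refl = count+1≤c
    ... | no _     = ≤-trans (≤-reflexive (+-identityʳ _)) (count≤c x)

  module _ (p : Carrier → ℚ) (0≤p : ∀ u → 0ℚ ≤ p u) (∑p≡1 : sum elements p ≡ 1ℚ) where

    -- Deadlines (count + 1) / p are compared after cross-multiplication, so that p may vanish. Only
    -- released u compete, since the SRT rule compares within T alone; the billiard rule gives more.
    EarliestDeadlineFirst : Set
    EarliestDeadlineFirst = ∀ i u → countℚ u i < fromℕ (suc i) * p u →
      (countℚ (s i) i + 1ℚ) * p u ≤ (countℚ u i + 1ℚ) * p (s i)

    -- The optimality of earliest-deadline-first scheduling, for jobs whose
    -- j-th copy at u is released at time (j − 1) / p u and due at j / p u:
    -- if u misses a deadline z, go back from z to the last choice k of a job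
    -- with deadline beyond z; the jobs chosen after k were all released after
    -- k and due by z, but there are too many of them to fit there.
    count-lower : EarliestDeadlineFirst → ∀ u z → fromℕ z * p u < countℚ u z + 1ℚ
    count-lower edf u z = ≰⇒> late⇒⊥
      where
      -- If x is chosen at all in the slots from k to z, then its last copy there has deadline count
      -- / p at most z.
      DueFrom : ℕ → Set
      DueFrom k = ∀ x → count x z ℕ.≤ count x k ⊎ countℚ x z ≤ fromℕ z * p x

      module _ (d k : ℕ) (d+k≡z : d ℕ.+ suc k ≡ z) (due : DueFrom (suc k))
               (beyond : fromℕ z * p (s k) < countℚ (s k) k + 1ℚ)
               (late : countℚ u z + 1ℚ ≤ fromℕ z * p u) where

        -- The capacity of x by time z: its count through slot k, plus its fair share of the d slots
        -- that follow. These sum to `suc k + d`, which is z.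
        c : Carrier → ℚ
        c x = countℚ x (suc k) + fromℕ d * p x

        sum-c : sum elements c ≤ fromℕ z
        sum-c = ≤-reflexive (trans (sum-+ elements (λ x → countℚ x (suc k)) _)
          (trans (cong₂ _+_ (sum-countℚ (suc k)) (sum-*-weights elements ∑p≡1 (fromℕ d)))
          (trans (sym (fromℕ-+ (suc k) d)) (cong fromℕ (trans (ℕ.+-comm (suc k) d) d+k≡z)))))

        z*p : ∀ x → fromℕ z * p x ≡ fromℕ (suc k) * p x + fromℕ d * p x
        z*p x = trans (cong (λ m → fromℕ m * p x) (trans (sym d+k≡z) (ℕ.+-comm d (suc k))))
          (trans (cong (_* p x) (fromℕ-+ (suc k) d)) (*-distribʳ-+ (p x) (fromℕ (suc k)) (fromℕ d)))

        -- With y = `s k`, the deadlines satisfy z < (count y k + 1) / p y ≤ (count x k + 1) / p x,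
        -- the second step because x competed against y in slot k.
        released⇒beyond : ∀ x → countℚ x k < fromℕ (suc k) * p x → fromℕ z * p x < countℚ x k + 1ℚ
        released⇒beyond x released = *-cancelʳ-<-nonNeg (p y) {{nonNegative (0≤p y)}} (begin-strict
          fromℕ z * p x * p y          ≡⟨ swap (fromℕ z) (p x) (p y) ⟩
          fromℕ z * p y * p x          <⟨ *-monoˡ-<-pos (p x) {{positive 0<px}} beyond ⟩
          (countℚ y k + 1ℚ) * p x      ≤⟨ edf k x released ⟩
          (countℚ x k + 1ℚ) * p y      ∎)
          where
          open ≤-Reasoning
          y = s k
          swap : ∀ a b c → a * b * c ≡ a * c * b
          swap = solve-∀ ℚ-ring
          0<px : 0ℚ < p x
          0<px = 0≤<*⇒0< (0≤fromℕ (suc k)) (0≤fromℕ (count x k)) released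

        -- An unreleased x already holds its share of the first k + 1 slots, so its capacity covers
        -- the full share `z * p x`.
        beyond-or-capped : ∀ x → fromℕ z * p x < countℚ x k + 1ℚ ⊎ fromℕ z * p x ≤ c x
        beyond-or-capped x = Sum.map (released⇒beyond x)
          (λ unreleased → ≤-trans (≤-reflexive (z*p x)) (+-monoˡ-≤ (fromℕ d * p x)
            (≤-trans unreleased (fromℕ-mono (count-mono-suc x k)))))
          (<⊎≥ (countℚ x k) (fromℕ (suc k) * p x))

        fits : ∀ x → countℚ x z ≤ c x
        -- If x is not chosen after slot k, its count is within c. Otherwise its last copy is due by
        -- z: a next deadline beyond z at time k then means, by integrality, that x gained no copy
        -- since k, and in the other case the share `z * p x` is itself within c.
        fits x = [ count≤⇒fits , (λ le → [ (λ zp< → count≤⇒fits (ℕ.≤-trans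
          (fromℕ<1+fromℕ⇒≤ (count x z) (count x k) (≤-<-trans le zp<)) (count-mono-suc x k)))
          , ≤-trans le ]′ (beyond-or-capped x)) ]′ (due x)
          where
          count≤⇒fits : count x z ℕ.≤ count x (suc k) → countℚ x z ≤ c x
          count≤⇒fits le = ≤-trans (fromℕ-mono le) (≤-+ʳ (0≤* (0≤fromℕ d) (0≤p x)))

        impossible : ⊥
        -- The late u cannot have its deadline beyond z, as its count has only grown since k. So its
        -- capacity covers `z * p u`, one unit more than its count, and the slots are overfull.
        impossible = [ (λ zp< → <⇒≱ zp< (≤-trans (+-monoˡ-≤ 1ℚ (fromℕ-mono
          (subst (λ m → count u k ℕ.≤ count u m) (trans (sym (ℕ.+-suc d k)) d+k≡z) (count-mono u (suc d) k)))) late))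
          , (λ zp≤c → not-overfull z c u fits (≤-trans late zp≤c) sum-c) ]′ (beyond-or-capped u)

      module _ (late : countℚ u z + 1ℚ ≤ fromℕ z * p u) where

        -- Runs backwards from k = z. The last choice with deadline beyond z is never searched for:
        -- each step refutes that slot k holds it, using that all later choices are due.
        dueFrom : ∀ d k → d ℕ.+ k ≡ z → DueFrom k
        dueFrom zero    k k≡z = λ x → inj₁ (ℕ.≤-reflexive (cong (count x) (sym k≡z)))
        dueFrom (suc d) k d+k≡z = λ x → [ unchosen x , inj₂ ]′ (due x)
          where
          d+sk≡z = trans (ℕ.+-suc d k) d+k≡z
          due = dueFrom d (suc k) d+sk≡z
          chosen-due : countℚ (s k) k + 1ℚ ≤ fromℕ z * p (s k)
          chosen-due = [ (λ beyond → ⊥-elim (impossible d k d+sk≡z due beyond late)) , id ]′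
            (<⊎≥ (fromℕ z * p (s k)) (countℚ (s k) k + 1ℚ))
          unchosen : ∀ x → count x z ℕ.≤ count x (suc k) → count x z ℕ.≤ count x k ⊎ countℚ x z ≤ fromℕ z * p x
          unchosen x le = Sum.map (λ eq → subst (count x z ℕ.≤_) eq le)
            (λ eq → ≤-trans (fromℕ-mono le) (subst (λ y → countℚ x (suc k) ≤ fromℕ z * p y) (proj₁ eq)
              (≤-trans (≤-reflexive (proj₂ eq)) chosen-due))) (count-step x k)

        early : ∀ x → countℚ x z ≤ fromℕ z * p x
        early x = [ (λ le → ≤-trans (fromℕ-mono le) (0≤* (0≤fromℕ z) (0≤p x))) , id ]′
          (dueFrom z 0 (ℕ.+-identityʳ z) x)

        late⇒⊥ : ⊥
        -- Once every choice is due by z, the fair shares `z * p x` themselves serve as capacities;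
        -- they sum to z.
        late⇒⊥ = not-overfull z (λ x → fromℕ z * p x) u early late (≤-reflexive (sum-*-weights elements ∑p≡1 (fromℕ z)))

    -- The count at u moves only when u is chosen, which is where `chosen` applies. Between such
    -- times the right-hand side only grows.
    count-upper : ∀ {D} → 0ℚ ≤ D → (∀ i → countℚ (s i) i + 1ℚ ≤ (fromℕ (suc i) + D) * p (s i)) →
      ∀ u z → countℚ u z ≤ (fromℕ z + D) * p u
    count-upper {D} 0≤D chosen u zero    = 0≤* (≤-trans 0≤D (≤-reflexive (sym (+-identityˡ D)))) (0≤p u)
    count-upper {D} 0≤D chosen u (suc z) = [
        (λ eq → ≤-trans (≤-reflexive (cong fromℕ eq)) (≤-trans (count-upper 0≤D chosen u z)
          (*-monoʳ (0≤p u) (+-monoˡ-≤ D (fromℕ-mono (ℕ.n≤1+n z))))))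
      , (λ (sz≡u , eq) → ≤-trans (≤-reflexive eq)
          (subst (λ v → countℚ (s z) z + 1ℚ ≤ (fromℕ (suc z) + D) * p v) sz≡u (chosen z)))
      ]′ (count-step u z)

    count-discrepancy : ∀ {D} → 0ℚ ≤ D → (∀ u → 0ℚ < p u → 1ℚ ≤ D * p u) → EarliestDeadlineFirst →
      (∀ i → countℚ (s i) i + 1ℚ ≤ (fromℕ (suc i) + D) * p (s i)) →
      ∀ u z → ∣ countℚ u z - fromℕ z * p u ∣ ≤ D * p u
    count-discrepancy {D} 0≤D 1≤Dp edf chosen u z = ∣p∣≤
      (0≤-⇒≤ (≤-trans (≤⇒0≤- (count-upper 0≤D chosen u z)) (≤-reflexive (rearrange (countℚ u z) (fromℕ z) D (p u)))))
      (0≤-⇒≤ (≤-trans (≤⇒0≤- lower) (≤-reflexive (rearrange′ (countℚ u z) (fromℕ z * p u) (D * p u)))))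
      where
      rearrange : ∀ n z D p → (z + D) * p - n ≡ D * p - (n - z * p)
      rearrange = solve-∀ ℚ-ring
      rearrange′ : ∀ n a b → (n + b) - a ≡ b - - (n - a)
      rearrange′ = solve-∀ ℚ-ring
      lower : fromℕ z * p u ≤ countℚ u z + D * p u
      -- The unit lost in `count-lower` is covered by `D * p u` where `p u` is positive; where it
      -- vanishes, so does the left-hand side.
      lower = [ (λ 0<p → ≤-trans (<⇒≤ (count-lower edf u z)) (+-monoʳ-≤ (countℚ u z) (1≤Dp u 0<p)))
              , (λ p≤0 → ≤-trans
                  (≤-trans (*-monoˡ (0≤fromℕ z) p≤0) (≤-reflexive (*-zeroʳ (fromℕ z))))
                  (≤-trans (0≤fromℕ (count u z)) (≤-+ʳ (0≤* 0≤D (0≤p u)))))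
              ]′ (<⊎≥ 0ℚ (p u))

length-filter-single : ∀ {A : Set} {Q : Pred A 0ℓ} (Q? : Decidable Q) x →
  length (filter Q? (x ∷ [])) ≡ (if ⌊ Q? x ⌋ then 1 else 0)
length-filter-single Q? x with Q? x
... | yes _ = refl
... | no _  = refl

÷-≤⇒*-≤ : ∀ {a b p q} (0<p : 0ℚ < p) (0<q : 0ℚ < q) →
  (a ÷ p) {{>-nonZero 0<p}} ≤ (b ÷ q) {{>-nonZero 0<q}} → a * q ≤ b * p
÷-≤⇒*-≤ {a} {b} {p} {q} 0<p 0<q a/p≤b/q = begin
  a * q                  ≡⟨ cong (_* q) (÷-* a p) ⟨
  (a ÷ p) * p * q        ≤⟨ *-monoʳ (<⇒≤ 0<q) (*-monoʳ (<⇒≤ 0<p) a/p≤b/q) ⟩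
  (b ÷ q) * p * q        ≡⟨ swap (b ÷ q) p q ⟩
  (b ÷ q) * q * p        ≡⟨ cong (_* p) (÷-* b q) ⟩
  b * p                  ∎
  where
  open ≤-Reasoning
  instance
    p≢0 = >-nonZero 0<p
    q≢0 = >-nonZero 0<q
  ÷-* : ∀ a p .{{_ : Data.Rational.NonZero p}} → (a ÷ p) * p ≡ a
  ÷-* a p = trans (*-assoc a (1/ p) p) (trans (cong (_*_ a) (*-inverseˡ p)) (*-identityʳ a))
  swap : ∀ a b c → a * b * c ≡ a * c * b
  swap = solve-∀ ℚ-ring

-- Summing a sequence that halves every τ steps.

module RangeSum (a : ℕ → ℚ) where

  -- T terms starting at index s. Peeling the first term matches the telescoping, where s grows as T
  -- shrinks.
  rangeSum : ℕ → ℕ → ℚ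
  rangeSum s zero    = 0ℚ
  rangeSum s (suc T) = a s + rangeSum (suc s) T

  rangeSum-+ : ∀ s m n → rangeSum s (m ℕ.+ n) ≡ rangeSum s m + rangeSum (m ℕ.+ s) n
  rangeSum-+ s zero    n = sym (+-identityˡ (rangeSum s n))
  rangeSum-+ s (suc m) n = trans
    (cong (_+_ (a s)) (trans (rangeSum-+ (suc s) m n)
      (cong (λ k → rangeSum (suc s) m + rangeSum k n) (ℕ.+-suc m s))))
    (sym (+-assoc (a s) (rangeSum (suc s) m) (rangeSum (suc (m ℕ.+ s)) n)))

  rangeSum-≤ : ∀ {M} → (∀ s → a s ≤ M) → ∀ s T → rangeSum s T ≤ fromℕ T * M
  rangeSum-≤ {M} a≤M s zero    = ≤-reflexive (sym (*-zeroˡ M))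
  rangeSum-≤ {M} a≤M s (suc T) = ≤-trans (+-mono-≤ (a≤M s) (rangeSum-≤ a≤M (suc s) T)) (≤-reflexive (c+m*c T M))

  module _ (0≤a : ∀ s → 0ℚ ≤ a s) where

    0≤rangeSum : ∀ s T → 0ℚ ≤ rangeSum s T
    0≤rangeSum s zero    = ≤-refl
    0≤rangeSum s (suc T) = ≤-trans (0≤a s) (≤-+ʳ (0≤rangeSum (suc s) T))

    module _ (τ : ℕ) (halves : ∀ s → a (τ ℕ.+ s) ≤ ½ * a s) where

      rangeSum-halves : ∀ s T → rangeSum (τ ℕ.+ s) T ≤ ½ * rangeSum s T
      rangeSum-halves s zero    = ≤-refl
      rangeSum-halves s (suc T) = ≤-trans
        (+-mono-≤ (halves s) (subst (λ k → rangeSum k T ≤ ½ * rangeSum (suc s) T) (ℕ.+-suc τ s) (rangeSum-halves (suc s) T)))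
        (≤-reflexive (sym (*-distribˡ-+ ½ (a s) (rangeSum (suc s) T))))

      -- The sum S bounds itself: appending τ more terms and then splitting off the first τ gives S
      -- ≤ τ M + S / 2. No division of T into blocks is needed, and τ = 0 is no special case.
      rangeSum-geometric : ∀ {M} → (∀ s → a s ≤ M) → ∀ T → rangeSum 0 T ≤ fromℕ 2 * (fromℕ τ * M)
      rangeSum-geometric {M} a≤M T = 0≤-⇒≤ (≤-trans (0≤* (0≤fromℕ 2) (≤⇒0≤- (begin
        rangeSum 0 T                              ≤⟨ ≤-+ʳ (0≤rangeSum (T ℕ.+ 0) τ) ⟩
        rangeSum 0 T + rangeSum (T ℕ.+ 0) τ       ≡⟨ rangeSum-+ 0 T τ ⟨
        rangeSum 0 (T ℕ.+ τ)                      ≡⟨ cong (rangeSum 0) (ℕ.+-comm T τ) ⟩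
        rangeSum 0 (τ ℕ.+ T)                      ≡⟨ rangeSum-+ 0 τ T ⟩
        rangeSum 0 τ + rangeSum (τ ℕ.+ 0) T       ≤⟨ +-mono-≤ (rangeSum-≤ a≤M 0 τ) (rangeSum-halves 0 T) ⟩
        fromℕ τ * M + ½ * rangeSum 0 T            ∎)))
        (≤-reflexive (rearrange (fromℕ τ * M) (rangeSum 0 T))))
        where
        open ≤-Reasoning
        rearrange : ∀ b x → fromℕ 2 * (b + ½ * x - x) ≡ fromℕ 2 * b - x
        -- The constants 2 and ½ enter the solver as variables; afterwards `t - t * h` evaluates to
        -- 1.
        rearrange b x = trans (expand b x (fromℕ 2) ½)
          (cong (λ y → fromℕ 2 * b - y) (*-identityˡ x))
          where
          expand : ∀ b x t h → t * (b + h * x - x) ≡ t * b - (t - t * h) * x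
          expand = solve-∀ ℚ-ring

-- Matrix products and the ℓ¹-norm.

module ListSums (A : Set) (xs : List A) where

  -- Associativity of the product of a row f, a matrix g and a column h.
  sum-assoc : ∀ (f : A → ℚ) (g : A → A → ℚ) (h : A → ℚ) →
    sum xs (λ v → f v * sum xs (λ x → g v x * h x)) ≡ sum xs (λ x → sum xs (λ v → f v * g v x) * h x)
  sum-assoc f g h = begin
    sum xs (λ v → f v * sum xs (λ x → g v x * h x))     ≡⟨ sum-cong xs (λ v → sum-*ˡ xs (f v) (λ x → g v x * h x)) ⟨
    sum xs (λ v → sum xs (λ x → f v * (g v x * h x)))   ≡⟨ sum-swap xs xs _ ⟩
    sum xs (λ x → sum xs (λ v → f v * (g v x * h x)))   ≡⟨ sum-cong xs (λ x → sum-cong xs (λ v → *-assoc (f v) (g v x) (h x))) ⟨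
    sum xs (λ x → sum xs (λ v → f v * g v x * h x))     ≡⟨ sum-cong xs (λ x → sum-*ʳ xs (λ v → f v * g v x) (h x)) ⟩
    sum xs (λ x → sum xs (λ v → f v * g v x) * h x)     ∎
    where open ≡-Reasoning

  ∥_∥₁ : (A → ℚ) → ℚ
  ∥ f ∥₁ = sum xs (λ x → ∣ f x ∣)

  -- Acting on rows, K has norm at most its largest row norm. For `P^ τ` this says that `distance`
  -- never grows, for `deviation τ` that it contracts.
  ∥∥₁-kernel : ∀ (g : A → ℚ) (K : A → A → ℚ) {c} → (∀ v → ∥ K v ∥₁ ≤ c) →
    ∥ (λ u → sum xs (λ v → g v * K v u)) ∥₁ ≤ ∥ g ∥₁ * c
  ∥∥₁-kernel g K {c} ∥K∥≤c = begin
    sum xs (λ u → ∣ sum xs (λ v → g v * K v u) ∣)          ≤⟨ sum-mono xs (λ u → ∣sum∣≤ xs (λ v → g v * K v u)) ⟩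
    sum xs (λ u → sum xs (λ v → ∣ g v * K v u ∣))          ≡⟨ sum-swap xs xs _ ⟩
    sum xs (λ v → sum xs (λ u → ∣ g v * K v u ∣))          ≡⟨ sum-cong xs (λ v → trans (sum-cong xs (λ u → ∣p*q∣≡∣p∣*∣q∣ (g v) (K v u)))
                                                                (sum-*ˡ xs ∣ g v ∣ (λ u → ∣ K v u ∣))) ⟩
    sum xs (λ v → ∣ g v ∣ * ∥ K v ∥₁)                       ≤⟨ sum-mono xs (λ v → *-monoˡ (0≤∣p∣ (g v)) (∥K∥≤c v)) ⟩
    sum xs (λ v → ∣ g v ∣ * c)                              ≡⟨ sum-*ʳ xs (λ v → ∣ g v ∣) c ⟩
    ∥ g ∥₁ * c                                              ∎
    where open ≤-Reasoning

-- Powers and mixing of a symmetric chain.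

module SymmetricChain
  (V : FiniteSet) (P : FiniteSet.Carrier V → FiniteSet.Carrier V → ℚ)
  (0≤P : ∀ v u → 0ℚ ≤ P v u)
  (∑P≡1 : ∀ v → sum (FiniteSet.elements V) (P v) ≡ 1ℚ)
  (P-sym : ∀ v u → P v u ≡ P u v) where

  open FiniteSet V
  open Chain V P
  open ListSums Carrier elements

  ∑P≡1′ : ∀ u → sum elements (λ v → P v u) ≡ 1ℚ
  ∑P≡1′ u = trans (sum-cong elements (λ v → P-sym v u)) (∑P≡1 u)

  P⁰ : ∀ v w → P^ 0 v w ≡ P^ 0 w v
  P⁰ v w with v ≟ w | w ≟ v
  ... | yes _   | yes _   = refl
  ... | no _    | no _    = refl
  ... | yes v≡w | no w≢v  = contradiction (sym v≡w) w≢v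
  ... | no v≢w  | yes w≡v = contradiction (sym w≡v) v≢w

  ∑P⁰* : ∀ (f : Carrier → ℚ) v → sum elements (λ u → P^ 0 v u * f u) ≡ f v
  ∑P⁰* f v = trans (sum-cong elements point) (sum-point _≟_ unique (complete v) f)
    where
    point : ∀ u → P^ 0 v u * f u ≡ (if ⌊ v ≟ u ⌋ then f u else 0ℚ)
    point u with v ≟ u
    ... | yes _ = *-identityˡ (f u)
    ... | no _  = *-zeroˡ (f u)

  ∑*P⁰ : ∀ (f : Carrier → ℚ) w → sum elements (λ u → f u * P^ 0 u w) ≡ f w
  ∑*P⁰ f w = trans (sum-cong elements (λ u → trans (*-comm (f u) (P^ 0 u w)) (cong (_* f u) (P⁰ u w))))
    (∑P⁰* f w)

  -- `P^` splits off its last step by definition. Symmetry of powers and the telescoping need the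
  -- first one, since transposition reverses products and errors arise before the remaining steps.
  P^-sucˡ : ∀ t v w → P^ (suc t) v w ≡ sum elements (λ u → P v u * P^ t u w)
  P^-sucˡ zero    v w = trans (∑P⁰* (λ u → P u w) v) (sym (∑*P⁰ (P v) w))
  P^-sucˡ (suc t) v w = trans (sum-cong elements (λ u → cong (_* P u w) (P^-sucˡ t v u)))
    (sym (sum-assoc (P v) (P^ t) (λ u → P u w)))

  P^-sym : ∀ t v w → P^ t v w ≡ P^ t w v
  P^-sym zero    v w = P⁰ v w
  P^-sym (suc t) v w = trans
    (sum-cong elements (λ u → trans (*-comm (P^ t v u) (P u w)) (cong₂ _*_ (P-sym u w) (P^-sym t v u))))
    (sym (P^-sucˡ t w v))

  P^-+ : ∀ τ s v w → sum elements (λ u → P^ s v u * P^ τ u w) ≡ P^ (τ ℕ.+ s) v w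
  P^-+ zero    s v w = ∑*P⁰ (P^ s v) w
  P^-+ (suc τ) s v w = trans (sum-assoc (P^ s v) (P^ τ) (λ x → P x w))
    (sum-cong elements (λ x → cong (_* P x w) (P^-+ τ s v x)))

  0≤P^ : ∀ t v w → 0ℚ ≤ P^ t v w
  0≤P^ zero    v w with v ≟ w
  ... | yes _ = 0≤fromℕ 1
  ... | no _  = ≤-refl
  0≤P^ (suc t) v w = sum-nonneg elements (λ u → 0≤* (0≤P^ t v u) (0≤P u w))

  ∑P^≡1 : ∀ t v → sum elements (P^ t v) ≡ 1ℚ
  ∑P^≡1 zero    v = sum-point _≟_ unique (complete v) (λ _ → 1ℚ)
  ∑P^≡1 (suc t) v = trans (sum-swap elements elements _)
    (trans (sum-cong elements (λ u → trans (sum-*ˡ elements (P^ t v u) (P u))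
      (trans (cong (_*_ (P^ t v u)) (∑P≡1 u)) (*-identityʳ (P^ t v u))))) (∑P^≡1 t v))

  ∑P^≡1′ : ∀ t u → sum elements (λ v → P^ t v u) ≡ 1ℚ
  ∑P^≡1′ t u = trans (sum-cong elements (λ v → P^-sym t v u)) (∑P^≡1 t u)

  π : Carrier → ℚ
  π = uniform V

  nonempty : Carrier → NonZero (length elements)
  nonempty v = ℕ.>-nonZero (∈-length (complete v))

  0≤π : ∀ v → 0ℚ ≤ π v
  0≤π v = 0≤/ 1 (length elements) {{nonempty v}}

  -- The argument of `uniform` enters only an irrelevant instance, so all values of π are
  -- definitionally equal and `π u` names the common one.
  ∑*π : ∀ (f : Carrier → ℚ) u → sum elements (λ v → f v * π v) ≡ sum elements f * π u
  ∑*π f u = sum-*ʳ elements f (π u)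

  ∑π≡1 : ∀ (v : Carrier) → sum elements π ≡ 1ℚ
  ∑π≡1 v = trans (sum-const elements (π v)) (trans (*-comm (fromℕ (length elements)) (π v))
    (/-*-cancel 1 (length elements) {{nonempty v}}))

  deviation : ℕ → Carrier → Carrier → ℚ
  deviation s w u = P^ s w u - π u

  ∑deviation≡0 : ∀ s w → sum elements (deviation s w) ≡ 0ℚ
  ∑deviation≡0 s w = trans (sum-- elements (P^ s w) π)
    (trans (cong₂ _-_ (∑P^≡1 s w) (∑π≡1 w)) (+-inverseʳ 1ℚ))

  distance : Carrier → ℕ → ℚ
  distance w s = ∥ deviation s w ∥₁

  0≤distance : ∀ w s → 0ℚ ≤ distance w s
  0≤distance w s = sum-nonneg elements (λ u → 0≤∣p∣ (deviation s w u))

  -- π is stationary because symmetry makes the columns of `P^ τ` sum to 1.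
  deviation-step : ∀ τ s w u → deviation (τ ℕ.+ s) w u ≡ sum elements (λ v → deviation s w v * P^ τ v u)
  deviation-step τ s w u = sym (begin
    sum elements (λ v → (P^ s w v - π v) * P^ τ v u)
      ≡⟨ sum-cong elements (λ v → distrib (P^ s w v) (π v) (P^ τ v u)) ⟩
    sum elements (λ v → P^ s w v * P^ τ v u - P^ τ v u * π v)
      ≡⟨ sum-- elements (λ v → P^ s w v * P^ τ v u) _ ⟩
    sum elements (λ v → P^ s w v * P^ τ v u) - sum elements (λ v → P^ τ v u * π v)
      ≡⟨ cong₂ _-_ (P^-+ τ s w u) (trans (∑*π (λ v → P^ τ v u) u) (trans (cong (_* π u) (∑P^≡1′ τ u)) (*-identityˡ (π u)))) ⟩
    P^ (τ ℕ.+ s) w u - π u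
      ∎)
    where
    open ≡-Reasoning
    distrib : ∀ a b c → (a - b) * c ≡ a * c - c * b
    distrib = solve-∀ ℚ-ring

  -- A row of sum zero does not see a constant subtracted from the matrix, so π may be removed from
  -- `P^ τ` as well.
  deviation-contract : ∀ τ s w u → deviation (τ ℕ.+ s) w u ≡ sum elements (λ v → deviation s w v * deviation τ v u)
  deviation-contract τ s w u = trans (deviation-step τ s w u) (sym (begin
    sum elements (λ v → g v * (P^ τ v u - π u))
      ≡⟨ sum-cong elements (λ v → distrib (g v) (P^ τ v u) (π u)) ⟩
    sum elements (λ v → g v * P^ τ v u - g v * π u)
      ≡⟨ sum-- elements (λ v → g v * P^ τ v u) _ ⟩
    sum elements (λ v → g v * P^ τ v u) - sum elements (λ v → g v * π u)
      ≡⟨ cong (λ x → sum elements (λ v → g v * P^ τ v u) - x) (trans (sum-*ʳ elements g (π u))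
           (trans (cong (_* π u) (∑deviation≡0 s w)) (*-zeroˡ (π u)))) ⟩
    sum elements (λ v → g v * P^ τ v u) - 0ℚ
      ≡⟨ +-identityʳ _ ⟩
    sum elements (λ v → g v * P^ τ v u)
      ∎))
    where
    open ≡-Reasoning
    g = deviation s w
    distrib : ∀ a b c → a * (b - c) ≡ a * b - a * c
    distrib = solve-∀ ℚ-ring

  ∥P^∥₁ : ∀ t v → ∥ P^ t v ∥₁ ≡ 1ℚ
  ∥P^∥₁ t v = trans (sum-cong elements (λ u → 0≤p⇒∣p∣≡p (0≤P^ t v u))) (∑P^≡1 t v)

  distance-antitone : ∀ τ s w → distance w (τ ℕ.+ s) ≤ distance w s
  distance-antitone τ s w = begin
    distance w (τ ℕ.+ s)                                            ≡⟨ sum-cong elements (λ u → cong ∣_∣ (deviation-step τ s w u)) ⟩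
    ∥ (λ u → sum elements (λ v → deviation s w v * P^ τ v u)) ∥₁    ≤⟨ ∥∥₁-kernel (deviation s w) (P^ τ) (λ v → ≤-reflexive (∥P^∥₁ τ v)) ⟩
    distance w s * 1ℚ                                               ≡⟨ *-identityʳ (distance w s) ⟩
    distance w s                                                    ∎
    where open ≤-Reasoning

  distance-contract : ∀ τ {c} → (∀ v → distance v τ ≤ c) → ∀ s w → distance w (τ ℕ.+ s) ≤ c * distance w s
  distance-contract τ {c} distance≤c s w = begin
    distance w (τ ℕ.+ s)                                                 ≡⟨ sum-cong elements (λ u → cong ∣_∣ (deviation-contract τ s w u)) ⟩
    ∥ (λ u → sum elements (λ v → deviation s w v * deviation τ v u)) ∥₁  ≤⟨ ∥∥₁-kernel (deviation s w) (deviation τ) distance≤c ⟩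
    distance w s * c                                                     ≡⟨ *-comm (distance w s) c ⟩
    c * distance w s                                                     ∎
    where open ≤-Reasoning

  distance≤2 : ∀ w s → distance w s ≤ fromℕ 2
  distance≤2 w s = begin
    distance w s                                      ≤⟨ sum-mono elements (λ u → ∣p-q∣≤∣p∣+∣q∣ (P^ s w u) (π u)) ⟩
    sum elements (λ u → ∣ P^ s w u ∣ + ∣ π u ∣)        ≡⟨ sum-+ elements (λ u → ∣ P^ s w u ∣) (λ u → ∣ π u ∣) ⟩
    ∥ P^ s w ∥₁ + ∥ π ∥₁                               ≡⟨ cong₂ _+_ (∥P^∥₁ s w) (trans (sum-cong elements (λ u → 0≤p⇒∣p∣≡p (0≤π u))) (∑π≡1 w)) ⟩
    1ℚ + 1ℚ                                            ∎
    where open ≤-Reasoning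

  -- Each start v has its own first time s ≤ τ, and monotonicity of `distance` carries the bound on
  -- to τ. As `dTV` is half of `distance`, the threshold 1/4 reads ½ * ½.
  mixed : ∀ {τ} → IsMixingTime π (+ 1 / 4) τ → ∀ v → distance v τ ≤ ½
  mixed {τ} mixing v = ≤-trans
    (subst (λ t → distance v t ≤ distance v s) (ℕ.m∸n+n≡m s≤τ) (distance-antitone (τ ℕ.∸ s) s v))
    (*-cancelˡ-≤-pos ½ dTV≤¼)
    where
    from = proj₁ mixing v
    s = proj₁ from
    s≤τ = proj₂ (proj₂ from)
    dTV≤¼ : ½ * distance v s ≤ + 1 / 4
    dTV≤¼ = proj₁ (proj₁ (proj₂ from))

  ∑distance : ∀ {τ} → IsMixingTime π (+ 1 / 4) τ → ∀ w T →
    RangeSum.rangeSum (distance w) 0 T ≤ fromℕ 2 * (fromℕ τ * fromℕ 2)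
  ∑distance {τ} mixing w = RangeSum.rangeSum-geometric (distance w) (0≤distance w) τ
    (λ s → distance-contract τ (mixed mixing) s w) (distance≤2 w)

  -- Discrepancy of the SRT and billiard routers.

  module _ {D : ℚ} (1≤DP : ∀ v u → 0ℚ < P v u → 1ℚ ≤ D * P v u) (0≤D : 0ℚ ≤ D)
           (σ : Router) (isSRT⊎isBilliard : IsSRT σ ⊎ IsBilliard σ) where

    -- Stated additively to avoid truncated subtraction, with windows in the form z to z + k that
    -- `Z` uses.
    I-count : ∀ v u z k → I[_,_] σ v u z (z ℕ.+ k) ℕ.+ Schedule.count V (σ v) u z ≡ Schedule.count V (σ v) u (z ℕ.+ k)
    I-count v u z k = trans (cong (λ m → chosen m ℕ.+ count u z) (ℕ.m+n∸m≡n z k)) (go k)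
      where
      open Schedule V (σ v)
      hits : List ℕ → ℕ
      hits js = length (filter (λ j → σ v j ≟ u) js)
      chosen : ℕ → ℕ
      chosen k = hits (applyUpTo (ℕ._+_ z) k)
      hit : ℕ → ℕ
      hit j = if ⌊ σ v j ≟ u ⌋ then 1 else 0
      hits-++ : ∀ js js′ → hits (js ++ js′) ≡ hits js ℕ.+ hits js′
      hits-++ js js′ = trans (cong length (filter-++ (λ j → σ v j ≟ u) js js′)) (length-++ (filter (λ j → σ v j ≟ u) js))
      chosen-suc : ∀ k → chosen (suc k) ≡ chosen k ℕ.+ hit (z ℕ.+ k)
      chosen-suc k = trans (cong hits (sym (applyUpTo-∷ʳ (ℕ._+_ z) k)))
        (trans (hits-++ (applyUpTo (ℕ._+_ z) k) _) (cong (ℕ._+_ (chosen k)) (length-filter-single (λ j → σ v j ≟ u) (z ℕ.+ k))))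
      swap : ∀ a b c → a ℕ.+ b ℕ.+ c ≡ a ℕ.+ c ℕ.+ b
      swap a b c = trans (ℕ.+-assoc a b c) (trans (cong (ℕ._+_ a) (ℕ.+-comm b c)) (sym (ℕ.+-assoc a c b)))
      go : ∀ k → chosen k ℕ.+ count u z ≡ count u (z ℕ.+ k)
      go zero    = cong (count u) (sym (ℕ.+-identityʳ z))
      go (suc k) = begin
        chosen (suc k) ℕ.+ count u z                         ≡⟨ cong (ℕ._+ count u z) (chosen-suc k) ⟩
        chosen k ℕ.+ hit (z ℕ.+ k) ℕ.+ count u z             ≡⟨ swap (chosen k) (hit (z ℕ.+ k)) (count u z) ⟩
        chosen k ℕ.+ count u z ℕ.+ hit (z ℕ.+ k)             ≡⟨ cong (ℕ._+ hit (z ℕ.+ k)) (go k) ⟩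
        count u (suc (z ℕ.+ k))                              ≡⟨ cong (count u) (ℕ.+-suc z k) ⟨
        count u (z ℕ.+ suc k)                                ∎
        where open ≡-Reasoning

    I₀-count : ∀ v u i → I[_,_] σ v u 0 i ≡ Schedule.count V (σ v) u i
    I₀-count v u i = trans (sym (ℕ.+-identityʳ _)) (I-count v u 0 i)

    module _ (v : Carrier) where

      open Schedule V (σ v)

      σ∈𝒩 : ∀ i → σ v i ∈𝒩 v
      σ∈𝒩 i = [ (λ srt → proj₁ (proj₁ (srt v i))) , (λ billiard → proj₁ (billiard v i)) ]′ isSRT⊎isBilliard

      priority⇒* : ∀ i u (0<P : u ∈𝒩 v) (0<Pσ : σ v i ∈𝒩 v) → priority σ v (σ v i) 0<Pσ i ≤ priority σ v u 0<P i →
        (countℚ (σ v i) i + 1ℚ) * P v u ≤ (countℚ u i + 1ℚ) * P v (σ v i)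
      priority⇒* i u 0<P 0<Pσ le = subst₂ (λ a b → (fromℕ a + 1ℚ) * P v u ≤ (fromℕ b + 1ℚ) * P v (σ v i))
        (I₀-count v (σ v i) i) (I₀-count v u i)
        (÷-≤⇒*-≤ {fromℕ (I[_,_] σ v (σ v i) 0 i) + 1ℚ} {fromℕ (I[_,_] σ v u 0 i) + 1ℚ} 0<Pσ 0<P le)

      -- To be released is to belong to T: the inequality is the same and forces `P v u` to be
      -- positive.
      edf : EarliestDeadlineFirst (P v) (0≤P v) (∑P≡1 v)
      edf i u released = [ (λ srt → priority⇒* i u 0<P (proj₁ (proj₁ (srt v i))) (proj₂ (srt v i) u (0<P , u∈T)))
                         , (λ billiard → priority⇒* i u 0<P (proj₁ (billiard v i)) (proj₂ (billiard v i) u 0<P)) ]′ isSRT⊎isBilliard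
        where
        0<P : 0ℚ < P v u
        0<P = 0≤<*⇒0< (0≤fromℕ (suc i)) (0≤fromℕ (count u i)) released
        u∈T : fromℕ (I[_,_] σ v u 0 i) - fromℕ (suc i) * P v u < 0ℚ
        u∈T = subst (λ a → fromℕ a - fromℕ (suc i) * P v u < 0ℚ) (sym (I₀-count v u i))
          (<-≤-trans (+-monoˡ-< (- (fromℕ (suc i) * P v u)) released) (≤-reflexive (+-inverseʳ (fromℕ (suc i) * P v u))))

      chosen-SRT : IsSRT σ → ∀ i → countℚ (σ v i) i + 1ℚ ≤ (fromℕ (suc i) + D) * P v (σ v i)
      chosen-SRT srt i = ≤-trans (+-mono-≤ (<⇒≤ count<) (1≤DP v (σ v i) (σ∈𝒩 i)))
        (≤-reflexive (sym (*-distribʳ-+ (P v (σ v i)) (fromℕ (suc i)) D)))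
        where
        cancel : ∀ a b → a - b + b ≡ a
        cancel = solve-∀ ℚ-ring
        count< : countℚ (σ v i) i < fromℕ (suc i) * P v (σ v i)
        count< = subst₂ _<_ (trans (cancel _ _) (cong fromℕ (I₀-count v (σ v i) i))) (+-identityˡ _)
          (+-monoˡ-< (fromℕ (suc i) * P v (σ v i)) (proj₂ (proj₁ (srt v i))))

      -- Sum the inequality between the priorities of σ v i and u over all u.
      chosen-billiard : IsBilliard σ → ∀ i → countℚ (σ v i) i + 1ℚ ≤ (fromℕ (suc i) + D) * P v (σ v i)
      chosen-billiard billiard i = begin
        x                                                           ≡⟨ sum-*-weights elements (∑P≡1 v) x ⟨
        sum elements (λ u → x * P v u)                              ≤⟨ sum-mono elements bound ⟩
        sum elements (λ u → (countℚ u i + D * P v u) * Pσ)          ≡⟨ sum-*ʳ elements _ Pσ ⟩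
        sum elements (λ u → countℚ u i + D * P v u) * Pσ            ≡⟨ cong (_* Pσ) (trans (sum-+ elements (λ u → countℚ u i) _)
                                                                         (cong₂ _+_ (sum-countℚ i) (sum-*-weights elements (∑P≡1 v) D))) ⟩
        -- Averaging yields `fromℕ i + D`, weakened here to the form that the SRT router also
        -- satisfies.
        (fromℕ i + D) * Pσ                                          ≤⟨ *-monoʳ (0≤P v (σ v i)) (+-monoˡ-≤ D (fromℕ-mono (ℕ.n≤1+n i))) ⟩
        (fromℕ (suc i) + D) * Pσ                                    ∎
        where
        open ≤-Reasoning
        x = countℚ (σ v i) i + 1ℚ
        Pσ = P v (σ v i)
        bound : ∀ u → x * P v u ≤ (countℚ u i + D * P v u) * Pσ
        bound u = [ (λ 0<P → ≤-trans (priority⇒* i u 0<P (proj₁ (billiard v i)) (proj₂ (billiard v i) u 0<P))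
                      (*-monoʳ (0≤P v (σ v i)) (+-monoʳ-≤ (countℚ u i) (1≤DP v u 0<P))))
                  , (λ P≤0 → ≤-trans
                      (≤-trans (*-monoˡ (≤-trans (0≤fromℕ (count (σ v i) i)) (≤-+ʳ (0≤fromℕ 1))) P≤0) (≤-reflexive (*-zeroʳ x)))
                      (0≤* (≤-trans (0≤fromℕ (count u i)) (≤-+ʳ (0≤* 0≤D (0≤P v u)))) (0≤P v (σ v i))))
                  ]′ (<⊎≥ 0ℚ (P v u))

      router-discrepancy : ∀ u z → ∣ countℚ u z - fromℕ z * P v u ∣ ≤ D * P v u
      router-discrepancy = count-discrepancy (P v) (0≤P v) (∑P≡1 v) 0≤D (1≤DP v) edf
        (λ i → [ (λ srt → chosen-SRT srt i) , (λ billiard → chosen-billiard billiard i) ]′ isSRT⊎isBilliard)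

      Iℚ : ∀ u z k → fromℕ (I[_,_] σ v u z (z ℕ.+ k)) ≡ countℚ u (z ℕ.+ k) - countℚ u z
      Iℚ u z k = trans (cancel _ (countℚ u z)) (cong (_- countℚ u z)
        (trans (sym (fromℕ-+ (I[_,_] σ v u z (z ℕ.+ k)) (count u z))) (cong fromℕ (I-count v u z k))))
        where
        cancel : ∀ a b → a ≡ a + b - b
        cancel = solve-∀ ℚ-ring

      -- A window is a difference of two prefixes, each off by at most `D * P v u`.
      window-discrepancy : ∀ u z k → ∣ fromℕ (I[_,_] σ v u z (z ℕ.+ k)) - fromℕ k * P v u ∣ ≤ fromℕ 2 * D * P v u
      window-discrepancy u z k = begin
        ∣ fromℕ (I[_,_] σ v u z (z ℕ.+ k)) - fromℕ k * P v u ∣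
          ≡⟨ cong ∣_∣ (trans (cong (_- fromℕ k * P v u) (Iℚ u z k))
               (trans (rearrange (countℚ u (z ℕ.+ k)) (countℚ u z) (fromℕ z) (fromℕ k) (P v u))
               (cong (λ m → countℚ u (z ℕ.+ k) - m * P v u - (countℚ u z - fromℕ z * P v u)) (sym (fromℕ-+ z k))))) ⟩
        ∣ (countℚ u (z ℕ.+ k) - fromℕ (z ℕ.+ k) * P v u) - (countℚ u z - fromℕ z * P v u) ∣
          ≤⟨ ∣p-q∣≤∣p∣+∣q∣ (countℚ u (z ℕ.+ k) - fromℕ (z ℕ.+ k) * P v u) (countℚ u z - fromℕ z * P v u) ⟩
        _ ≤⟨ +-mono-≤ (router-discrepancy u (z ℕ.+ k)) (router-discrepancy u z) ⟩
        D * P v u + D * P v u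
          ≡⟨ twice D (P v u) ⟩
        fromℕ 2 * D * P v u
          ∎
        where
        open ≤-Reasoning
        rearrange : ∀ a b z k p → a - b - k * p ≡ a - (z + k) * p - (b - z * p)
        rearrange = solve-∀ ℚ-ring
        twice : ∀ d p → d * p + d * p ≡ (1ℚ + 1ℚ) * d * p
        twice = solve-∀ ℚ-ring

      sum-I : ∀ z k → sum elements (λ u → fromℕ (I[_,_] σ v u z (z ℕ.+ k))) ≡ fromℕ k
      sum-I z k = begin
        sum elements (λ u → fromℕ (I[_,_] σ v u z (z ℕ.+ k)))      ≡⟨ sum-cong elements (λ u → Iℚ u z k) ⟩
        sum elements (λ u → countℚ u (z ℕ.+ k) - countℚ u z)       ≡⟨ sum-- elements (λ u → countℚ u (z ℕ.+ k)) (λ u → countℚ u z) ⟩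
        sum elements (λ u → countℚ u (z ℕ.+ k)) - sum elements (λ u → countℚ u z)
          ≡⟨ cong₂ _-_ (trans (sum-countℚ (z ℕ.+ k)) (fromℕ-+ z k)) (sum-countℚ z) ⟩
        fromℕ z + fromℕ k - fromℕ z                                ≡⟨ cancel (fromℕ z) (fromℕ k) ⟩
        fromℕ k                                                    ∎
        where
        open ≡-Reasoning
        cancel : ∀ a b → a + b - a ≡ b
        cancel = solve-∀ ℚ-ring

    -- Propagation of the one-step errors.

    module _ (χ₀ : Carrier → ℕ) where

      χℚ : ℕ → Carrier → ℚ
      χℚ t v = fromℕ (χ σ χ₀ t v)

      pushed : ℕ → Carrier → ℚ
      pushed t u = sum elements (λ v → χℚ t v * P v u)

      error : ℕ → Carrier → ℚ
      error t u = χℚ (suc t) u - pushed t u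

      χℚ-suc : ∀ t u → χℚ (suc t) u ≡ sum elements (λ v → fromℕ (Z σ χ₀ t v u))
      χℚ-suc t u = fromℕ-sum elements (λ v → Z σ χ₀ t v u)

      ∣error∣≤ : ∀ t u → ∣ error t u ∣ ≤ fromℕ 2 * D
      ∣error∣≤ t u = begin
        ∣ error t u ∣                                                        ≡⟨ cong ∣_∣ (trans (cong (_- pushed t u) (χℚ-suc t u))
                                                                                 (sym (sum-- elements (λ v → fromℕ (Z σ χ₀ t v u)) (λ v → χℚ t v * P v u)))) ⟩
        ∣ sum elements (λ v → fromℕ (Z σ χ₀ t v u) - χℚ t v * P v u) ∣       ≤⟨ ∣sum∣≤ elements (λ v → fromℕ (Z σ χ₀ t v u) - χℚ t v * P v u) ⟩
        sum elements (λ v → ∣ fromℕ (Z σ χ₀ t v u) - χℚ t v * P v u ∣)       ≤⟨ sum-mono elements (λ v → window-discrepancy v u (before σ χ₀ t v) (χ σ χ₀ t v)) ⟩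
        sum elements (λ v → fromℕ 2 * D * P v u)                             ≡⟨ sum-*ˡ elements (fromℕ 2 * D) (λ v → P v u) ⟩
        fromℕ 2 * D * sum elements (λ v → P v u)                             ≡⟨ cong (_*_ (fromℕ 2 * D)) (∑P≡1′ u) ⟩
        fromℕ 2 * D * 1ℚ                                                     ≡⟨ *-identityʳ (fromℕ 2 * D) ⟩
        fromℕ 2 * D                                                          ∎
        where open ≤-Reasoning

      ∑error≡0 : ∀ t → sum elements (error t) ≡ 0ℚ
      ∑error≡0 t = begin
        sum elements (error t)                                  ≡⟨ sum-- elements (χℚ (suc t)) (pushed t) ⟩
        sum elements (χℚ (suc t)) - sum elements (pushed t)     ≡⟨ cong₂ _-_ arrived departed ⟩
        sum elements (χℚ t) - sum elements (χℚ t)               ≡⟨ +-inverseʳ (sum elements (χℚ t)) ⟩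
        0ℚ                                                      ∎
        where
        open ≡-Reasoning
        arrived : sum elements (χℚ (suc t)) ≡ sum elements (χℚ t)
        arrived = trans (sum-cong elements (χℚ-suc t)) (trans (sum-swap elements elements _)
          (sum-cong elements (λ v → sum-I v (before σ χ₀ t v) (χ σ χ₀ t v))))
        departed : sum elements (pushed t) ≡ sum elements (χℚ t)
        departed = trans (sum-swap elements elements _)
          (sum-cong elements (λ v → sum-*-weights elements (∑P≡1 v) (χℚ t v)))

      propagated : ℕ → ℕ → Carrier → ℚ
      propagated T s w = sum elements (λ v → χℚ T v * P^ s v w)

      -- The sum runs down the column of w; `P^-sym` turns it into the row of w, so that the
      -- distance from π of the chain started at w appears.
      ∑error*P^ : ∀ t s w → sum elements (λ v → error t v * P^ s v w) ≡ sum elements (λ v → error t v * deviation s w v)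
      ∑error*P^ t s w = sym (begin
        sum elements (λ v → error t v * (P^ s w v - π v))
          ≡⟨ sum-cong elements (λ v → trans (distrib (error t v) (P^ s w v) (π v))
               (cong (λ x → error t v * x - error t v * π v) (P^-sym s w v))) ⟩
        sum elements (λ v → error t v * P^ s v w - error t v * π v)
          ≡⟨ sum-- elements (λ v → error t v * P^ s v w) (λ v → error t v * π v) ⟩
        sum elements (λ v → error t v * P^ s v w) - sum elements (λ v → error t v * π v)
          ≡⟨ cong (λ x → sum elements (λ v → error t v * P^ s v w) - x)
               (trans (∑*π (error t) w) (trans (cong (_* π w) (∑error≡0 t)) (*-zeroˡ (π w)))) ⟩
        sum elements (λ v → error t v * P^ s v w) - 0ℚ
          ≡⟨ +-identityʳ _ ⟩
        sum elements (λ v → error t v * P^ s v w)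
          ∎)
        where
        open ≡-Reasoning
        distrib : ∀ a b c → a * (b - c) ≡ a * b - a * c
        distrib = solve-∀ ℚ-ring

      ∣∑error*P^∣≤ : ∀ t s w → ∣ sum elements (λ v → error t v * P^ s v w) ∣ ≤ fromℕ 2 * D * distance w s
      ∣∑error*P^∣≤ t s w = begin
        ∣ sum elements (λ v → error t v * P^ s v w) ∣           ≡⟨ cong ∣_∣ (∑error*P^ t s w) ⟩
        ∣ sum elements (λ v → error t v * deviation s w v) ∣    ≤⟨ ∣sum∣≤ elements (λ v → error t v * deviation s w v) ⟩
        sum elements (λ v → ∣ error t v * deviation s w v ∣)    ≤⟨ sum-mono elements (λ v → ≤-trans
                                                                    (≤-reflexive (∣p*q∣≡∣p∣*∣q∣ (error t v) (deviation s w v)))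
                                                                    (*-monoʳ (0≤∣p∣ (deviation s w v)) (∣error∣≤ t v))) ⟩
        sum elements (λ v → fromℕ 2 * D * ∣ deviation s w v ∣)  ≡⟨ sum-*ˡ elements (fromℕ 2 * D) (λ v → ∣ deviation s w v ∣) ⟩
        fromℕ 2 * D * distance w s                              ∎
        where open ≤-Reasoning

      propagated-suc : ∀ t s w → propagated (suc t) s w ≡ propagated t (suc s) w + sum elements (λ v → error t v * P^ s v w)
      propagated-suc t s w = begin
        sum elements (λ v → χℚ (suc t) v * P^ s v w)
          ≡⟨ sum-cong elements (λ v → split (χℚ (suc t) v) (pushed t v) (P^ s v w)) ⟩
        sum elements (λ v → pushed t v * P^ s v w + error t v * P^ s v w)
          ≡⟨ sum-+ elements (λ v → pushed t v * P^ s v w) (λ v → error t v * P^ s v w) ⟩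
        sum elements (λ v → pushed t v * P^ s v w) + sum elements (λ v → error t v * P^ s v w)
          ≡⟨ cong (_+ sum elements (λ v → error t v * P^ s v w))
               (trans (sym (sum-assoc (χℚ t) P (λ v → P^ s v w)))
                 (sum-cong elements (λ v → cong (_*_ (χℚ t v)) (sym (P^-sucˡ s v w))))) ⟩
        propagated t (suc s) w + sum elements (λ v → error t v * P^ s v w)
          ∎
        where
        open ≡-Reasoning
        split : ∀ a b c → a * c ≡ b * c + (a - b) * c
        split = solve-∀ ℚ-ring

      -- With s general, each induction step trades one router step for one chain step at fixed T +
      -- s. At T = 0, `propagated` is μ by definition.
      propagated-discrepancy : ∀ T s w →
        ∣ propagated T s w - μ χ₀ (T ℕ.+ s) w ∣ ≤ fromℕ 2 * D * RangeSum.rangeSum (distance w) s T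
      propagated-discrepancy zero    s w = ≤-reflexive
        (trans (cong ∣_∣ (+-inverseʳ (μ χ₀ s w))) (sym (*-zeroʳ (fromℕ 2 * D))))
      propagated-discrepancy (suc T) s w = begin
        ∣ propagated (suc T) s w - μ χ₀ (suc T ℕ.+ s) w ∣
          ≡⟨ cong ∣_∣ (trans (cong₂ _-_ (propagated-suc T s w) (cong (λ m → μ χ₀ m w) (sym (ℕ.+-suc T s))))
               (rearrange (propagated T (suc s) w) (sum elements (λ v → error T v * P^ s v w)) (μ χ₀ (T ℕ.+ suc s) w))) ⟩
        ∣ sum elements (λ v → error T v * P^ s v w) + (propagated T (suc s) w - μ χ₀ (T ℕ.+ suc s) w) ∣
          ≤⟨ ∣p+q∣≤∣p∣+∣q∣ (sum elements (λ v → error T v * P^ s v w)) (propagated T (suc s) w - μ χ₀ (T ℕ.+ suc s) w) ⟩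
        _ ≤⟨ +-mono-≤ (∣∑error*P^∣≤ T s w) (propagated-discrepancy T (suc s) w) ⟩
        _ ≡⟨ *-distribˡ-+ (fromℕ 2 * D) (distance w s) (RangeSum.rangeSum (distance w) (suc s) T) ⟨
        fromℕ 2 * D * RangeSum.rangeSum (distance w) s (suc T)
          ∎
        where
        open ≤-Reasoning
        rearrange : ∀ a b c → a + b - c ≡ b + (a - c)
        rearrange = solve-∀ ℚ-ring

      discrepancy : ∀ {τ} → IsMixingTime π (+ 1 / 4) τ → ∀ T w →
        ∣ χℚ T w - μ χ₀ T w ∣ ≤ fromℕ 2 * D * (fromℕ 2 * (fromℕ τ * fromℕ 2))
      discrepancy mixing T w = ≤-trans
        (subst₂ (λ p t → ∣ p - μ χ₀ t w ∣ ≤ fromℕ 2 * D * RangeSum.rangeSum (distance w) 0 T)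
          (∑*P⁰ (χℚ T) w) (ℕ.+-identityʳ T) (propagated-discrepancy T 0 w))
        (*-monoˡ (0≤* (0≤fromℕ 2) 0≤D) (∑distance mixing w T))

-- The hypercube and the knapsack chain.

lookup-injective : ∀ {A : Set} {xs : List A} → Unique xs → ∀ i j → List.lookup xs i ≡ List.lookup xs j → i ≡ j
lookup-injective (_    ∷ _)   zero    zero    _  = refl
lookup-injective (x∉xs ∷ _)   zero    (suc j) eq = contradiction eq (All.lookup x∉xs (∈-lookup j))
lookup-injective (x∉xs ∷ _)   (suc i) zero    eq = contradiction (sym eq) (All.lookup x∉xs (∈-lookup i))
lookup-injective (_    ∷ xs!) (suc i) (suc j) eq = cong suc (lookup-injective xs! i j eq)

length-≤ : ∀ {A B : Set} {xs : List A} {ys : List B} (f : A → B) → (∀ {x y} → f x ≡ f y → x ≡ y) →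
  Unique xs → (∀ {x} → x ∈ xs → f x ∈ ys) → length xs ℕ.≤ length ys
length-≤ {B = B} {xs} {ys} f f-injective xs! f∈ys = Fin.injective⇒≤ {f = λ i → index (f∈ys (∈-lookup i))}
  λ {i} {j} eq → lookup-injective xs! i j (f-injective
    (Membership.index-injective (setoid B) (f∈ys (∈-lookup i)) (f∈ys (∈-lookup j)) eq))

‖-‖₁-self : ∀ {n} (x : 𝔹 n) → ‖ x - x ‖₁ ≡ 0
‖-‖₁-self []      = refl
‖-‖₁-self (i ∷ x) = cong₂ ℕ._+_ (ℕ.∣n-n∣≡0 (toℕ i)) (‖-‖₁-self x)

‖-‖₁-comm : ∀ {n} (x y : 𝔹 n) → ‖ x - y ‖₁ ≡ ‖ y - x ‖₁
‖-‖₁-comm []      []      = refl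
‖-‖₁-comm (i ∷ x) (j ∷ y) = cong₂ ℕ._+_ (ℕ.∣-∣-comm (toℕ i) (toℕ j)) (‖-‖₁-comm x y)

‖-‖₁≡0⇒≡ : ∀ {n} (x y : 𝔹 n) → ‖ x - y ‖₁ ≡ 0 → y ≡ x
‖-‖₁≡0⇒≡ []      []      _  = refl
‖-‖₁≡0⇒≡ (i ∷ x) (j ∷ y) eq = cong₂ _∷_
  (sym (Fin.toℕ-injective (ℕ.∣m-n∣≡0⇒m≡n (ℕ.m+n≡0⇒m≡0 _ eq)))) (‖-‖₁≡0⇒≡ x y (ℕ.m+n≡0⇒n≡0 _ eq))

flip : ∀ {n} → 𝔹 n → Fin n → 𝔹 n
flip x i = updateAt x i opposite

-- Coordinates differ by 0 or 1, so a distance of 1 is spent at a single position. This caps the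
-- number of neighbours at n.
‖-‖₁≡1⇒flip : ∀ {n} (x y : 𝔹 n) → ‖ x - y ‖₁ ≡ 1 → ∃ λ i → y ≡ flip x i
‖-‖₁≡1⇒flip []             []             ()
‖-‖₁≡1⇒flip (zero     ∷ x) (zero     ∷ y) eq = let i , y≡ = ‖-‖₁≡1⇒flip x y eq in suc i , cong (zero ∷_) y≡
‖-‖₁≡1⇒flip (suc zero ∷ x) (suc zero ∷ y) eq = let i , y≡ = ‖-‖₁≡1⇒flip x y eq in suc i , cong (suc zero ∷_) y≡
‖-‖₁≡1⇒flip (zero     ∷ x) (suc zero ∷ y) eq = zero , cong (suc zero ∷_) (‖-‖₁≡0⇒≡ x y (ℕ.suc-injective eq))
‖-‖₁≡1⇒flip (suc zero ∷ x) (zero     ∷ y) eq = zero , cong (zero ∷_) (‖-‖₁≡0⇒≡ x y (ℕ.suc-injective eq))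

module KnapsackChain {n : ℕ} .{{_ : NonZero n}} (a : Vec ℕ n) (b : ℕ) where

  open Knapsack a b
  open FiniteSet Ω

  instance
    2*n≢0 : NonZero (2 ℕ.* n)
    2*n≢0 = ℕ.m*n≢0 2 n

  ∣𝒩∣≤n : ∀ x → length (𝒩-Kna x) ℕ.≤ n
  ∣𝒩∣≤n x = ℕ.≤-trans
    (length-≤ value Refinement.value-injective (Unique.filter⁺ (adjacent? x) unique) flipped)
    (ℕ.≤-reflexive (trans (length-map (flip (value x)) (allFin n)) (length-tabulate {n = n} id)))
    where
    flipped : ∀ {y} → y ∈ 𝒩-Kna x → value y ∈ map (flip (value x)) (allFin n)
    flipped {y} y∈ = let i , y≡ = ‖-‖₁≡1⇒flip (value x) (value y) (proj₂ (∈-filter⁻ (adjacent? x) {xs = elements} y∈))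
      in subst (_∈ map (flip (value x)) (allFin n)) (sym y≡) (∈-map⁺ (flip (value x)) (∈-allFin i))

  D step : ℚ
  D    = fromℕ (2 ℕ.* n)
  step = + 1 / (2 ℕ.* n)

  stay : Solution → ℚ
  stay x = 1ℚ - + length (𝒩-Kna x) / (2 ℕ.* n)

  D*step≡1 : D * step ≡ 1ℚ
  D*step≡1 = trans (*-comm D step) (/-*-cancel 1 (2 ℕ.* n))

  0≤step : 0ℚ ≤ step
  0≤step = 0≤/ 1 (2 ℕ.* n)

  -- Multiplied out, `D * stay x` is 2n - |𝒩|, and |𝒩| ≤ n. Thus holding obeys the same lower bound
  -- 1/D as moving.
  1≤D*stay : ∀ x → 1ℚ ≤ D * stay x
  1≤D*stay x = begin
    1ℚ                                                     ≤⟨ fromℕ-mono (ℕ.>-nonZero⁻¹ n) ⟩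
    fromℕ n                                                ≡⟨ cancel (fromℕ n) (fromℕ n) ⟩
    fromℕ n + fromℕ n - fromℕ n                            ≤⟨ +-monoʳ-≤ (fromℕ n + fromℕ n) (neg-antimono-≤ (fromℕ-mono (∣𝒩∣≤n x))) ⟩
    fromℕ n + fromℕ n - fromℕ N                            ≡⟨ cong (_- fromℕ N) (trans (sym (fromℕ-+ n n)) (cong (λ m → fromℕ (n ℕ.+ m)) (sym (ℕ.+-identityʳ n)))) ⟩
    D - fromℕ N                                            ≡⟨ cong (λ y → D - y) (/-*-cancel N (2 ℕ.* n)) ⟨
    D - (+ N / (2 ℕ.* n)) * D                              ≡⟨ factor D (+ N / (2 ℕ.* n)) ⟩
    D * stay x                                             ∎
    where
    open ≤-Reasoning
    N = length (𝒩-Kna x)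
    cancel : ∀ a b → a ≡ a + b - b
    cancel = solve-∀ ℚ-ring
    factor : ∀ d q → d - q * d ≡ d * (1ℚ - q)
    factor = solve-∀ ℚ-ring

  0≤stay : ∀ x → 0ℚ ≤ stay x
  0≤stay x = begin
    0ℚ                     ≤⟨ 0≤* 0≤step (≤-trans (0≤fromℕ 1) (1≤D*stay x)) ⟩
    step * (D * stay x)    ≡⟨ *-assoc step D (stay x) ⟨
    step * D * stay x      ≡⟨ cong (_* stay x) (/-*-cancel 1 (2 ℕ.* n)) ⟩
    1ℚ * stay x            ≡⟨ *-identityˡ (stay x) ⟩
    stay x                 ∎
    where open ≤-Reasoning

  -- A view of `P-Kna x y` that stores its value as an equation, so that later case distinctions
  -- need not unfold the two decisions.
  data Transition (x y : Solution) : Set where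
    move   : ‖ value x - value y ‖₁ ≡ 1 → P-Kna x y ≡ step → Transition x y
    remain : x ≡ y → P-Kna x y ≡ stay x → Transition x y
    never  : ‖ value x - value y ‖₁ ≢ 1 → x ≢ y → P-Kna x y ≡ 0ℚ → Transition x y

  transition : ∀ x y → Transition x y
  transition x y = classify (adjacent? x y) (x ≟ y) refl
    where
    classify : ∀ (adj? : Dec (‖ value x - value y ‖₁ ≡ 1)) (eq? : Dec (x ≡ y)) →
      P-Kna x y ≡ (if ⌊ adj? ⌋ then step else if ⌊ eq? ⌋ then stay x else 0ℚ) → Transition x y
    classify (yes adj) _        P≡ = move adj P≡
    classify (no ¬adj) (yes eq) P≡ = remain eq P≡
    classify (no ¬adj) (no ¬eq) P≡ = never ¬adj ¬eq P≡

  P-sym : ∀ x y → P-Kna x y ≡ P-Kna y x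
  P-sym x y = go (transition x y) (transition y x)
    where
    go : Transition x y → Transition y x → P-Kna x y ≡ P-Kna y x
    go (remain x≡y _)   _                = cong₂ P-Kna x≡y (sym x≡y)
    go _                (remain y≡x _)   = cong₂ P-Kna (sym y≡x) y≡x
    go (move _ p)       (move _ q)       = trans p (sym q)
    go (never _ _ p)    (never _ _ q)    = trans p (sym q)
    go (move adj _)     (never ¬adj _ _) = contradiction (trans (‖-‖₁-comm (value y) (value x)) adj) ¬adj
    go (never ¬adj _ _) (move adj _)     = contradiction (trans (‖-‖₁-comm (value x) (value y)) adj) ¬adj

  0≤P : ∀ x y → 0ℚ ≤ P-Kna x y
  0≤P x y = go (transition x y)
    where
    go : Transition x y → 0ℚ ≤ P-Kna x y
    go (move _ p)    = ≤-trans 0≤step (≤-reflexive (sym p))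
    go (remain _ p)  = ≤-trans (0≤stay x) (≤-reflexive (sym p))
    go (never _ _ p) = ≤-reflexive (sym p)

  1≤D*P : ∀ x y → 0ℚ < P-Kna x y → 1ℚ ≤ D * P-Kna x y
  1≤D*P x y 0<P = go (transition x y)
    where
    go : Transition x y → 1ℚ ≤ D * P-Kna x y
    go (move _ p)    = ≤-reflexive (trans (sym D*step≡1) (cong (_*_ D) (sym p)))
    go (remain _ p)  = ≤-trans (1≤D*stay x) (≤-reflexive (cong (_*_ D) (sym p)))
    go (never _ _ p) = contradiction 0<P (<-irrefl (sym p))

  ∑P≡1 : ∀ x → sum elements (P-Kna x) ≡ 1ℚ
  ∑P≡1 x = begin
    sum elements (P-Kna x)
      ≡⟨ sum-cong elements (λ y → split (adjacent? x y) (x ≟ y)) ⟩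
    sum elements (λ y → (if ⌊ adjacent? x y ⌋ then step else 0ℚ) + (if ⌊ x ≟ y ⌋ then stay x else 0ℚ))
      ≡⟨ sum-+ elements (λ y → if ⌊ adjacent? x y ⌋ then step else 0ℚ) (λ y → if ⌊ x ≟ y ⌋ then stay x else 0ℚ) ⟩
    sum elements (λ y → if ⌊ adjacent? x y ⌋ then step else 0ℚ) + sum elements (λ y → if ⌊ x ≟ y ⌋ then stay x else 0ℚ)
      ≡⟨ cong₂ _+_ (sum-indicator elements (adjacent? x) step) (sum-point _≟_ unique (complete x) (λ _ → stay x)) ⟩
    fromℕ N * step + stay x
      ≡⟨ cong (_+ stay x) (m/n≡m*1/n N (2 ℕ.* n)) ⟨
    (+ N / (2 ℕ.* n)) + stay x
      ≡⟨ cancel (+ N / (2 ℕ.* n)) ⟩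
    1ℚ
      ∎
    where
    open ≡-Reasoning
    N = length (𝒩-Kna x)
    cancel : ∀ q → q + (1ℚ - q) ≡ 1ℚ
    cancel = solve-∀ ℚ-ring
    -- The nested conditional is a sum of two indicators because x is at distance 0, not 1, from
    -- itself.
    split : ∀ {y} (adj? : Dec (‖ value x - value y ‖₁ ≡ 1)) (eq? : Dec (x ≡ y)) →
      (if ⌊ adj? ⌋ then step else if ⌊ eq? ⌋ then stay x else 0ℚ) ≡
      (if ⌊ adj? ⌋ then step else 0ℚ) + (if ⌊ eq? ⌋ then stay x else 0ℚ)
    split (yes adj) (yes refl) = contradiction (trans (sym (‖-‖₁-self (value x))) adj) λ ()
    split (yes _)   (no _)     = sym (+-identityʳ step)
    split (no _)    (yes _)    = sym (+-identityˡ (stay x))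
    split (no _)    (no _)     = refl

  open SymmetricChain Ω P-Kna 0≤P ∑P≡1 P-sym
  open Chain Ω P-Kna

  knapsack-discrepancy : ∀ {τ} → IsMixingTime (uniform Ω) (+ 1 / 4) τ →
    ∀ σ → IsSRT σ ⊎ IsBilliard σ → ∀ χ₀ T w →
    ∣ fromℕ (χ σ χ₀ T w) - μ χ₀ T w ∣ ≤ fromℕ 16 * fromℕ n * fromℕ τ
  knapsack-discrepancy {τ} mixing σ routing χ₀ T w = ≤-trans
    (discrepancy 1≤D*P (0≤fromℕ (2 ℕ.* n)) σ routing χ₀ mixing T w)
    (≤-reflexive (trans (cong (λ d → fromℕ 2 * d * (fromℕ 2 * (fromℕ τ * fromℕ 2))) D≡)
      (collect (fromℕ 2) (fromℕ n) (fromℕ τ))))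
    where
    D≡ : D ≡ fromℕ 2 * fromℕ n
    D≡ = trans (trans (fromℕ-+ n (n ℕ.+ 0)) (cong (λ m → fromℕ n + fromℕ m) (ℕ.+-identityʳ n))) (twice (fromℕ n))
      where
      twice : ∀ m → m + m ≡ (1ℚ + 1ℚ) * m
      twice = solve-∀ ℚ-ring
    -- At t = 2 the fourth power evaluates to 16: two factors from the window bound and D, two from
    -- the sum of distances.
    collect : ∀ t m τ → t * (t * m) * (t * (τ * t)) ≡ t * t * t * t * m * τ
    collect = solve-∀ ℚ-ring

-- Powers and real exponents.

open CommutativeSemiringExp (CommutativeRing.commutativeSemiring +-*-commutativeRing)
  using (^-homo-*; ^-distrib-*)

0≤^ : ∀ {x} → 0ℚ ≤ x → ∀ k → 0ℚ ≤ x ^ℚ k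
0≤^ 0≤x zero    = 0≤fromℕ 1
0≤^ 0≤x (suc k) = 0≤* 0≤x (0≤^ 0≤x k)

^-mono-≤ : ∀ {x y} → 0ℚ ≤ x → x ≤ y → ∀ k → x ^ℚ k ≤ y ^ℚ k
^-mono-≤ 0≤x x≤y zero    = ≤-refl
^-mono-≤ 0≤x x≤y (suc k) = ≤-trans (*-monoʳ (0≤^ 0≤x k) x≤y)
  (*-monoˡ (≤-trans 0≤x x≤y) (^-mono-≤ 0≤x x≤y k))

module _ (d : ℕ) .{{_ : NonZero d}} where

  private
    m m⁻¹ : ℚ
    m   = fromℕ d
    m⁻¹ = + 1 / d

    m*m⁻¹≡1 : m * m⁻¹ ≡ 1ℚ
    m*m⁻¹≡1 = trans (*-comm m m⁻¹) (/-*-cancel 1 d)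

    instance
      m-positive : Positive m
      m-positive = positive (<-≤-trans (positive⁻¹ 1ℚ) (fromℕ-mono (ℕ.>-nonZero⁻¹ d)))
      m⁻¹-positive : Positive m⁻¹
      m⁻¹-positive = normalize-pos 1 d

    *-cancel : ∀ q → m * q * m⁻¹ ≡ q
    *-cancel q = trans (swap m q m⁻¹) (trans (cong (_* q) m*m⁻¹≡1) (*-identityˡ q))
      where
      swap : ∀ a b c → a * b * c ≡ a * c * b
      swap = solve-∀ ℚ-ring

    *-cancel′ : ∀ q → m * (q * m⁻¹) ≡ q
    *-cancel′ q = trans (sym (*-assoc m q m⁻¹)) (*-cancel q)

  infixr 7 _·ʳ_

  -- A rational q lies below d·C exactly when q / d lies below C, so every cut axiom transports
  -- along division by d.
  _·ʳ_ : ℝ → ℝ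
  _·ʳ_ C = record
    { L           = λ q → L (q * m⁻¹)
    ; U           = λ q → U (q * m⁻¹)
    ; L-inhabited = let q , l = L-inhabited in m * q , subst L (sym (*-cancel q)) l
    ; U-inhabited = let q , u = U-inhabited in m * q , subst U (sym (*-cancel q)) u
    ; L-lower     = λ q<r → L-lower (*-monoˡ-<-pos m⁻¹ q<r)
    ; L-open      = λ {q} l → let r , q<r , l′ = L-open l in
                      m * r , subst (_< m * r) (*-cancel′ q) (*-monoʳ-<-pos m q<r) , subst L (sym (*-cancel r)) l′
    ; U-upper     = λ q<r → U-upper (*-monoˡ-<-pos m⁻¹ q<r)
    ; U-open      = λ {r} u → let q , q<r , u′ = U-open u in
                      m * q , subst (m * q <_) (*-cancel′ r) (*-monoʳ-<-pos m q<r) , subst U (sym (*-cancel q)) u′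
    ; disjoint    = disjoint
    ; located     = λ q<r → located (*-monoˡ-<-pos m⁻¹ q<r)
    }
    where open ℝ C

L<U : ∀ (α : ℝ) {x y} → ℝ.L α x → ℝ.U α y → x < y
L<U α {x} {y} l u = ≰⇒> λ y≤x → [ (λ y<x → ℝ.disjoint α (l , ℝ.U-upper α y<x u))
                                , (λ x≤y → ℝ.disjoint α (l , subst (ℝ.U α) (≤-antisym y≤x x≤y) u)) ]′ (<⊎≥ y x)

module _ (C α : ℝ) (0<α : Positiveʳ α) {x : ℚ} (0≤x : 0ℚ ≤ x) (n τ : ℕ) (m : ℕ) .{{_ : NonZero m}}
         (x≤mnτ : x ≤ fromℕ m * fromℕ n * fromℕ τ) (τ≤ : fromℕ τ ≤ C · n ^ (+ 9 / 2 +ʳ α)) where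

  -- Since α > 0, the hypothesis U forces p / q > 11/2; so (p − q) / q is a
  -- legitimate exponent at which to use the bound on τ.
  raise-exponent : x ≤ (m ·ʳ C) · n ^ (+ 11 / 2 +ʳ α)
  raise-exponent c p q Uc Up = begin
    x ^ℚ q                                              ≤⟨ ^-mono-≤ 0≤x x≤mnτ q ⟩
    (M * N * fromℕ τ) ^ℚ q                              ≡⟨ trans (^-distrib-* (M * N) (fromℕ τ) q) (cong (_* fromℕ τ ^ℚ q) (^-distrib-* M N q)) ⟩
    M ^ℚ q * N ^ℚ q * fromℕ τ ^ℚ q                      ≤⟨ *-monoˡ (0≤* (0≤^ (0≤fromℕ m) q) (0≤^ (0≤fromℕ n) q)) (τ≤ e k q Uc (subst (ℝ.U α) exponent Up)) ⟩
    M ^ℚ q * N ^ℚ q * (e ^ℚ q * N ^ℚ k)                 ≡⟨ rearrange (M ^ℚ q) (N ^ℚ q) (e ^ℚ q) (N ^ℚ k) ⟩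
    (M ^ℚ q * e ^ℚ q) * (N ^ℚ k * N ^ℚ q)               ≡⟨ cong₂ _*_ (^-distrib-* M e q) (^-homo-* N k q) ⟨
    (M * e) ^ℚ q * N ^ℚ (k ℕ.+ q)                       ≡⟨ cong₂ (λ y j → y ^ℚ q * N ^ℚ j) M*e≡c (ℕ.m∸n+n≡m q≤p) ⟩
    c ^ℚ q * N ^ℚ p                                     ∎
    where
    open ≤-Reasoning
    M N e : ℚ
    M = fromℕ m
    N = fromℕ n
    -- By definition of `m ·ʳ C`, the hypothesis `Uc` says that this e is in the upper cut of C.
    e = c * (+ 1 / m)
    k : ℕ
    k = p ℕ.∸ q
    rearrange : ∀ a b c d → a * b * (c * d) ≡ (a * c) * (d * b)
    rearrange = solve-∀ ℚ-ring
    M*e≡c : M * e ≡ c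
    M*e≡c = trans (swap M c (+ 1 / m)) (trans (cong (_* c) (/-*-cancel 1 m)) (*-identityˡ c))
      where
      swap : ∀ a b c → a * (b * c) ≡ c * a * b
      swap = solve-∀ ℚ-ring
    q/q≡1 : fromℕ q * (+ 1 / q) ≡ 1ℚ
    q/q≡1 = trans (*-comm (fromℕ q) (+ 1 / q)) (/-*-cancel 1 q)
    11/2<p/q : + 11 / 2 < + p / q
    -- `Up` places p/q - 11/2 in the upper cut of α, while 0 is in the lower one.
    11/2<p/q = subst₂ _<_ (+-identityˡ (+ 11 / 2)) (cancel (+ p / q) (+ 11 / 2))
      (+-monoˡ-< (+ 11 / 2) (L<U α 0<α Up))
      where
      cancel : ∀ a b → a - b + b ≡ a
      cancel = solve-∀ ℚ-ring
    q≤p : q ℕ.≤ p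
    q≤p = ℕ.≮⇒≥ λ p<q → <⇒≱ 11/2<p/q (≤-trans
      (≤-trans (≤-reflexive (m/n≡m*1/n p q)) (≤-trans (*-monoʳ (0≤/ 1 q) (fromℕ-mono (ℕ.<⇒≤ p<q))) (≤-reflexive q/q≡1)))
      (toWitness {a? = 1ℚ ≤? (+ 11 / 2)} _))
    -- As p/q = k/q + 1 and 1 - 11/2 evaluates to -9/2, both bounds test the cut of α at the same
    -- rational.
    exponent : + p / q - + 11 / 2 ≡ + k / q - + 9 / 2
    exponent = trans (cong (_- + 11 / 2) p/q) (+-assoc (+ k / q) 1ℚ (- (+ 11 / 2)))
      where
      p/q : + p / q ≡ + k / q + 1ℚ
      p/q = trans (m/n≡m*1/n p q) (trans (cong (λ j → fromℕ j * (+ 1 / q)) (sym (ℕ.m∸n+n≡m q≤p)))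
        (trans (cong (_* (+ 1 / q)) (fromℕ-+ k q)) (trans (*-distribʳ-+ (+ 1 / q) (fromℕ k) (fromℕ q))
        (cong₂ _+_ (sym (m/n≡m*1/n k q)) q/q≡1))))

theorem6p2 : ((α : ℝ) → Positiveʳ α →
    Σ ℝ λ C → Positiveʳ C ×
    (∀ (n : ℕ) .{{_ : NonZero n}} (a : Vec ℕ n) (b : ℕ) → All (_> 0) a → b > 0 →
    let open Knapsack a b
        open Chain Ω P-Kna in
    ∃[ τ ] (IsMixingTime (uniform Ω) (+ 1 / 4) τ ×
    fromℕ τ ≤ C · n ^ (+ 9 / 2 +ʳ α)))) →
    (α : ℝ) → Positiveʳ α →
    Σ ℝ λ C′ → Positiveʳ C′ ×
    (∀ (n : ℕ) .{{_ : NonZero n}} (a : Vec ℕ n) (b : ℕ) → All (_> 0) a → b > 0 →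
    let open Knapsack a b
        open Chain Ω P-Kna in
    ∀ (σ : Router) → IsFunctionalRouter σ → IsSRT σ ⊎ IsBilliard σ →
    ∀ (χ₀ : Solution → ℕ) (T : ℕ) (w : Solution) →
    ∣ fromℕ (χ σ χ₀ T w) - μ χ₀ T w ∣ ≤ C′ · n ^ (+ 11 / 2 +ʳ α))
theorem6p2 mixing α 0<α =
  let C , 0<C , bound = mixing α 0<α in
  -- Positivity of `16 ·ʳ C` unfolds to C having `0ℚ * (+ 1 / 16)` in its lower cut.
  16 ·ʳ C , subst (ℝ.L C) (sym (*-zeroˡ (+ 1 / 16))) 0<C ,
  λ n a b 0<a 0<b σ _ routing χ₀ T w →
    let open Knapsack a b
        open Chain Ω P-Kna
        τ , isMixing , τ≤ = bound n a b 0<a 0<b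
    in raise-exponent C α 0<α (0≤∣p∣ (fromℕ (χ σ χ₀ T w) - μ χ₀ T w)) n τ 16
         (KnapsackChain.knapsack-discrepancy a b isMixing σ routing χ₀ T w) τ≤
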